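{- Let $p\ge 5$ be a prime and let $n,i\ge 1$ be integers with $i<\frac{p}{3}$. Then $$a_i(pn)\equiv 0\pmod{p^2}.$$
   Context: For integers $i\ge 0$ and $n\ge 1$, define $$a_i(n)=\sum_{k=0}^{\lfloor (n-i)/3\rfloor}(-1)^{n-k}\binom{3k+i}{k}\binom{2k+i}{k}\binom{n}{3k+i}\binom{n+k}{k}3^{n-3k-i}.$$ -}

module Defs where

open import Data.Nat.Base using (ℕ; _+_; _*_; _∸_; _^_; _/_)
open import Data.Nat.Combinatorics using (_C_)
open import Data.Fin.Base using (toℕ)
open import Data.Integer.Base as ℤ using (ℤ; +_; -1ℤ)
open import Data.Integer.Properties using (+-*-semiring)
open import Algebra.Properties.Semiring.Sum +-*-semiring using (sum⁺-syntax)

-- For k in the range of summation, 3k + i ≤ n whenever i ≤ n, so neither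
-- subtraction is truncated.
aTerm : (i n k : ℕ) → ℤ
aTerm i n k =
  (-1ℤ ℤ.^ (n ∸ k)) ℤ.*
  (+ (((3 * k + i) C k) * ((2 * k + i) C k) * (n C (3 * k + i)) * ((n + k) C k)
      * 3 ^ (n ∸ (3 * k + i))))

-- If n < i the sum is empty on paper; here it consists of the k = 0 term
-- alone, which vanishes because n C i = 0.
a : (i n : ℕ) → ℤ
a i n = ∑[ k ≤ (n ∸ i) / 3 ] aTerm i n (toℕ k)

{-# OPTIONS --safe #-}

-- Write N = pn and let x k be the k-th term of a i N. Consecutive terms satisfy
--   27 (k+1)³ (k+1+i) x (k+1) = (3k+i−N) (3k+i+1−N) (3k+i+2−N) (N+k+1) x k,
-- so in a block k = qp + r, 0 ≤ r < p, divisibility propagates upwards from r = 0, where p divides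
-- the binomial N C (3k+i). Let m be the least r for which p divides (3r+i) (3r+i+1) (3r+i+2).
-- The terms with r > m vanish modulo p²: one numerator factor gains a second p at r = m, and at
-- r = p−i, where the denominator factor k+1+i loses it again, two of the binomials carry.
-- Modulo p the ratios x (k+1) / x k for r < m are those of the summands of a terminating
-- Pfaff–Saalschütz series. One of its parameters is congruent to −m, and lifting the other two to
-- positive integers turns the summand into (−1)^r (m C r) P(r) with P a polynomial of degree
-- m − 1, so the sum is an m-th difference of P and vanishes.
module Submission where

open import Defs
open import Data.Nat.Base using (ℕ; _*_; _^_; _≤_; _<_)
open import Data.Nat.Primality using (Prime)
open import Data.Integer.Base using (+_)
open import Data.Integer.Divisibility using (_∣_)

open import Data.Fin.Base using (Fin; toℕ)
open import Data.Fin.Patterns using (0F; 1F; 2F)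
open import Data.Integer.Base as ℤ using (ℤ; 0ℤ; 1ℤ; -1ℤ)
open import Data.Integer.Divisibility.Signed as ℤ∣ using () renaming (_∣_ to _∣ₛ_)
open import Data.Integer.Properties as ℤₚ using (pos-+; pos-*)
import Data.Integer.Tactic.RingSolver as ℤ-Ring
open import Data.Nat.Base using (zero; suc; _+_; _∸_; _/_; _%_; z≤n; s≤s; _!; nonTrivial⇒n>1)
open import Data.Nat.Combinatorics
  using (_C_; nC1≡n; nCk+nC[k+1]≡[n+1]C[k+1]; k>n⇒nCk≡0; nCk≡n!/k![n-k]!; k![n∸k]!∣n!)
open import Data.Nat.DivMod using (_divMod_; result; m/n≤m; m/n*n≡m; m≡m%n+[m/n]*n; m%n<n)
open import Data.Nat.Divisibility as ℕ∣ using () renaming (_∣_ to _∣ₙ_)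
open import Data.Nat.Primality using (euclidsLemma; prime⇒irreducible; prime⇒nonTrivial; prime⇒nonZero)
open import Data.Nat.Properties
import Data.Nat.Tactic.RingSolver as ℕ-Ring
open import Data.Product using (_,_)
open import Data.Sum using (inj₁; inj₂)
open import Relation.Binary.PropositionalEquality
open import Relation.Nullary using (¬_; yes; no; contradiction)

open import Algebra.Properties.Semiring.Sum ℤₚ.+-*-semiring using (sum-syntax; sum-cong-≗; sum-replicate-zero)

-- Sums over initial segments

sumBelow : ℕ → (ℕ → ℤ) → ℤ
sumBelow n f = ∑[ k < n ] f (toℕ k)

sumBelow-+ : ∀ m n f → sumBelow (m + n) f ≡ sumBelow m f ℤ.+ sumBelow n (λ k → f (m + k))
sumBelow-+ zero    n f = sym (ℤₚ.+-identityˡ _)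
sumBelow-+ (suc m) n f = trans (cong (ℤ._+_ (f 0)) (sumBelow-+ m n (λ k → f (suc k))))
                               (sym (ℤₚ.+-assoc (f 0) _ _))

sumBelow-suc : ∀ n f → sumBelow (suc n) f ≡ sumBelow n f ℤ.+ f n
sumBelow-suc zero    f = ℤₚ.+-comm (f 0) 0ℤ
sumBelow-suc (suc n) f = trans (cong (ℤ._+_ (f 0)) (sumBelow-suc n (λ k → f (suc k))))
                               (sym (ℤₚ.+-assoc (f 0) _ _))

sumBelow-cong : ∀ n {f g} → (∀ k → f k ≡ g k) → sumBelow n f ≡ sumBelow n g
sumBelow-cong n f≗g = sum-cong-≗ {n} (λ k → f≗g (toℕ k))

sumBelow-∸ : ∀ n f g → sumBelow n (λ k → f k ℤ.- g k) ≡ sumBelow n f ℤ.- sumBelow n g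
sumBelow-∸ zero    f g = refl
sumBelow-∸ (suc n) f g =
  trans (cong (ℤ._+_ (f 0 ℤ.- g 0)) (sumBelow-∸ n (λ k → f (suc k)) (λ k → g (suc k)))) (regroup (f 0) (g 0) _ _)
  where
  regroup : ∀ u v x y → u ℤ.- v ℤ.+ (x ℤ.- y) ≡ u ℤ.+ x ℤ.- (v ℤ.+ y)
  regroup = ℤ-Ring.solve-∀

sumBelow-* : ∀ n c f → sumBelow n (λ k → c ℤ.* f k) ≡ c ℤ.* sumBelow n f
sumBelow-* zero    c f = sym (ℤₚ.*-zeroʳ c)
sumBelow-* (suc n) c f = trans (cong (ℤ._+_ (c ℤ.* f 0)) (sumBelow-* n c (λ k → f (suc k)))) (sym (ℤₚ.*-distribˡ-+ c _ _))

sumBelow-∣ : ∀ {d} n f → (∀ k → k < n → d ∣ₛ f k) → d ∣ₛ sumBelow n f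
sumBelow-∣ zero    f d∣f = ℤ∣.divides 0ℤ refl
sumBelow-∣ (suc n) f d∣f =
  ℤ∣.∣m∣n⇒∣m+n (d∣f 0 (s≤s z≤n)) (sumBelow-∣ n (λ k → f (suc k)) (λ k k<n → d∣f (suc k) (s≤s k<n)))

sumBelow-blocks-∣ : ∀ {d} p n f → (∀ q → d ∣ₛ sumBelow p (λ r → f (q * p + r))) →
                    d ∣ₛ sumBelow (n * p) f
sumBelow-blocks-∣ p zero    f d∣f = ℤ∣.divides 0ℤ refl
-- `suc n * p` unfolds to `p + n * p`; commuting puts the new block last, at offset `n * p`.
sumBelow-blocks-∣ p (suc n) f d∣f rewrite +-comm p (n * p) | sumBelow-+ (n * p) p f =
  ℤ∣.∣m∣n⇒∣m+n (sumBelow-blocks-∣ p n f d∣f) (d∣f n)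

-- Absorption identities for binomial coefficients

-- The rule (k+1) C(n,k+1) = (n-k) C(n,k) with the subtraction moved across, so that it holds for k
-- > n as well. Induction through Pascal's rule.
[k+1]*nC[k+1]+k*nCk≡n*nCk : ∀ n k → suc k * (n C suc k) + k * (n C k) ≡ n * (n C k)
[k+1]*nC[k+1]+k*nCk≡n*nCk n       zero rewrite nC1≡n n =
  trans (+-identityʳ _) (trans (*-identityˡ n) (sym (*-identityʳ n)))
[k+1]*nC[k+1]+k*nCk≡n*nCk zero    (suc k) = cong₂ _+_ (*-zeroʳ (suc (suc k))) (*-zeroʳ (suc k))
[k+1]*nC[k+1]+k*nCk≡n*nCk (suc n) (suc k) = begin
  suc (suc k) * (suc n C suc (suc k)) + suc k * (suc n C suc k)
    ≡⟨ cong₂ (λ u v → suc (suc k) * u + suc k * v)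
         (sym (nCk+nC[k+1]≡[n+1]C[k+1] n (suc k))) (sym (nCk+nC[k+1]≡[n+1]C[k+1] n k)) ⟩
  suc (suc k) * (y + z) + suc k * (x + y)
    ≡⟨ regroup k x y z ⟩
  (suc (suc k) * z + suc k * y) + (suc k * y + k * x) + (y + x)
    ≡⟨ cong₂ (λ u v → u + v + (y + x))
         ([k+1]*nC[k+1]+k*nCk≡n*nCk n (suc k)) ([k+1]*nC[k+1]+k*nCk≡n*nCk n k) ⟩
  n * y + n * x + (y + x)
    ≡⟨ collect n x y ⟩
  suc n * (x + y)
    ≡⟨ cong (suc n *_) (nCk+nC[k+1]≡[n+1]C[k+1] n k) ⟩
  suc n * (suc n C suc k) ∎
  where
  open ≡-Reasoning
  x = n C k
  y = n C suc k
  z = n C suc (suc k)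
  regroup : ∀ k x y z → suc (suc k) * (y + z) + suc k * (x + y) ≡
                        (suc (suc k) * z + suc k * y) + (suc k * y + k * x) + (y + x)
  regroup = ℕ-Ring.solve-∀
  collect : ∀ n x y → n * y + n * x + (y + x) ≡ suc n * (x + y)
  collect = ℕ-Ring.solve-∀

[k+1]*[n+1]C[k+1]≡[n+1]*nCk : ∀ n k → suc k * (suc n C suc k) ≡ suc n * (n C k)
[k+1]*[n+1]C[k+1]≡[n+1]*nCk n k = begin
  suc k * (suc n C suc k)                        ≡⟨ cong (suc k *_) (nCk+nC[k+1]≡[n+1]C[k+1] n k) ⟨
  suc k * (n C k + n C suc k)                    ≡⟨ regroup k (n C k) (n C suc k) ⟩
  n C k + (suc k * (n C suc k) + k * (n C k))    ≡⟨ cong (_+_ (n C k)) ([k+1]*nC[k+1]+k*nCk≡n*nCk n k) ⟩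
  suc n * (n C k)                                ∎
  where
  open ≡-Reasoning
  regroup : ∀ k x y → suc k * (x + y) ≡ x + (suc k * y + k * x)
  regroup = ℕ-Ring.solve-∀

-- Finite differences

-- In Pochhammer notation this is (-m)_r / r!, the factor that makes the hypergeometric series
-- terminate.
signedC : ℕ → ℕ → ℤ
signedC m r = (-1ℤ ℤ.^ r) ℤ.* + (m C r)

signedC-pascal : ∀ m r → signedC (suc m) (suc r) ≡ signedC m (suc r) ℤ.- signedC m r
signedC-pascal m r
  rewrite sym (nCk+nC[k+1]≡[n+1]C[k+1] m r) | pos-+ (m C r) (m C suc r) =
  expand (-1ℤ ℤ.^ r) (+ (m C r)) (+ (m C suc r))
  where
  expand : ∀ s x y → -1ℤ ℤ.* s ℤ.* (x ℤ.+ y) ≡ -1ℤ ℤ.* s ℤ.* y ℤ.- s ℤ.* x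
  expand = ℤ-Ring.solve-∀

signedC-step : ∀ m r → + suc r ℤ.* signedC m (suc r) ≡ (+ r ℤ.- + m) ℤ.* signedC m r
signedC-step m r = begin
  + suc r ℤ.* (-1ℤ ℤ.* s ℤ.* y)                     ≡⟨ isolate (+ suc r) (+ r) s x y ⟩
  s ℤ.* (+ r ℤ.* x ℤ.- (+ suc r ℤ.* y ℤ.+ + r ℤ.* x)) ≡⟨ cong (λ u → s ℤ.* (+ r ℤ.* x ℤ.- u)) absorb ⟩
  s ℤ.* (+ r ℤ.* x ℤ.- + m ℤ.* x)                   ≡⟨ factor s (+ r) (+ m) x ⟩
  (+ r ℤ.- + m) ℤ.* (s ℤ.* x)                       ∎
  where
  open ≡-Reasoning
  s = -1ℤ ℤ.^ r
  x = + (m C r)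
  y = + (m C suc r)
  absorb : + suc r ℤ.* y ℤ.+ + r ℤ.* x ≡ + m ℤ.* x
  absorb = begin
    + suc r ℤ.* y ℤ.+ + r ℤ.* x            ≡⟨ cong₂ ℤ._+_ (pos-* (suc r) (m C suc r)) (pos-* r (m C r)) ⟨
    + (suc r * (m C suc r) + r * (m C r))  ≡⟨ cong +_ ([k+1]*nC[k+1]+k*nCk≡n*nCk m r) ⟩
    + (m * (m C r))                        ≡⟨ pos-* m (m C r) ⟩
    + m ℤ.* x                              ∎
  isolate : ∀ r′ r s x y → r′ ℤ.* (-1ℤ ℤ.* s ℤ.* y) ≡ s ℤ.* (r ℤ.* x ℤ.- (r′ ℤ.* y ℤ.+ r ℤ.* x))
  isolate = ℤ-Ring.solve-∀
  factor : ∀ s r m x → s ℤ.* (r ℤ.* x ℤ.- m ℤ.* x) ≡ (r ℤ.- m) ℤ.* (s ℤ.* x)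
  factor = ℤ-Ring.solve-∀

-- The negative of the usual forward difference: with this sign the m-th iterate at 0 is the sum of
-- (-1)^r C(m,r) f(r), without an outer factor (-1)^m.
Δ : (ℕ → ℤ) → ℕ → ℤ
Δ f r = f r ℤ.- f (suc r)

Δ^_at0 : ℕ → (ℕ → ℤ) → ℤ
Δ^ zero  at0 f = f 0
Δ^ suc m at0 f = Δ^ m at0 (Δ f)

-- Pascal's rule splits the sum for `suc m` into the sum for `m` against `f r` minus the one against
-- `f (suc r)`, that is, the sum for `m` against `Δ f`.
sum-signedC≡Δ^ : ∀ m f → sumBelow (suc m) (λ r → signedC m r ℤ.* f r) ≡ Δ^ m at0 f
sum-signedC≡Δ^ zero    f = trans (ℤₚ.+-identityʳ _) (ℤₚ.*-identityˡ (f 0))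
sum-signedC≡Δ^ (suc m) f = begin
  signedC (suc m) 0 ℤ.* f 0 ℤ.+ sumBelow (suc m) (λ r → signedC (suc m) (suc r) ℤ.* f (suc r))
    ≡⟨ cong (ℤ._+_ (signedC m 0 ℤ.* f 0)) (trans (sumBelow-cong (suc m) split)
         (sumBelow-∸ (suc m) (λ r → g (suc r)) (λ r → signedC m r ℤ.* f (suc r)))) ⟩
  signedC m 0 ℤ.* f 0 ℤ.+ (sumBelow (suc m) (λ r → g (suc r)) ℤ.- h)
    ≡⟨ ℤₚ.+-assoc (g 0) _ _ ⟨
  sumBelow (suc (suc m)) g ℤ.- h
    ≡⟨ cong (ℤ._- h) (sumBelow-suc (suc m) g) ⟩
  sumBelow (suc m) g ℤ.+ g (suc m) ℤ.- h
    ≡⟨ cong (λ u → sumBelow (suc m) g ℤ.+ u ℤ.- h) overflow ⟩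
  sumBelow (suc m) g ℤ.+ 0ℤ ℤ.- h
    ≡⟨ cong (ℤ._- h) (ℤₚ.+-identityʳ (sumBelow (suc m) g)) ⟩
  sumBelow (suc m) g ℤ.- h
    ≡⟨ sumBelow-∸ (suc m) g (λ r → signedC m r ℤ.* f (suc r)) ⟨
  sumBelow (suc m) (λ r → g r ℤ.- signedC m r ℤ.* f (suc r))
    ≡⟨ sumBelow-cong (suc m) (λ r → factor (signedC m r) (f r) (f (suc r))) ⟩
  sumBelow (suc m) (λ r → signedC m r ℤ.* Δ f r)
    ≡⟨ sum-signedC≡Δ^ m (Δ f) ⟩
  Δ^ suc m at0 f ∎
  where
  open ≡-Reasoning
  g : ℕ → ℤ
  g r = signedC m r ℤ.* f r
  h = sumBelow (suc m) (λ r → signedC m r ℤ.* f (suc r))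
  factor : ∀ s x y → s ℤ.* x ℤ.- s ℤ.* y ≡ s ℤ.* (x ℤ.- y)
  factor = ℤ-Ring.solve-∀
  distrib : ∀ s t x → (s ℤ.- t) ℤ.* x ≡ s ℤ.* x ℤ.- t ℤ.* x
  distrib = ℤ-Ring.solve-∀
  split : ∀ r → signedC (suc m) (suc r) ℤ.* f (suc r) ≡ g (suc r) ℤ.- signedC m r ℤ.* f (suc r)
  split r = trans (cong (ℤ._* f (suc r)) (signedC-pascal m r)) (distrib (signedC m (suc r)) (signedC m r) (f (suc r)))
  -- The split leaves one extra index r = m + 1, where m C (m + 1) = 0.
  overflow : g (suc m) ≡ 0ℤ
  overflow = cong (ℤ._* f (suc m))
    (trans (cong (λ c → (-1ℤ ℤ.^ suc m) ℤ.* + c) (k>n⇒nCk≡0 (n<1+n m))) (ℤₚ.*-zeroʳ (-1ℤ ℤ.^ suc m)))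

-- By differences: this avoids coefficients, and allows integer-valued polynomials.
DegreeBelow : ℕ → (ℕ → ℤ) → Set
DegreeBelow zero    f = ∀ r → f r ≡ 0ℤ
DegreeBelow (suc d) f = DegreeBelow d (Δ f)

DegreeBelow-cong : ∀ d {f g} → (∀ r → f r ≡ g r) → DegreeBelow d f → DegreeBelow d g
DegreeBelow-cong zero    f≗g f≡0 r = trans (sym (f≗g r)) (f≡0 r)
DegreeBelow-cong (suc d) f≗g deg   = DegreeBelow-cong d (λ r → cong₂ ℤ._-_ (f≗g r) (f≗g (suc r))) deg

DegreeBelow-∸ : ∀ d f g → DegreeBelow d f → DegreeBelow d g → DegreeBelow d (λ r → f r ℤ.- g r)
DegreeBelow-∸ zero    f g f≡0 g≡0 r = cong₂ ℤ._-_ (f≡0 r) (g≡0 r)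
DegreeBelow-∸ (suc d) f g degf degg =
  DegreeBelow-cong d (λ r → exchange (f r) (f (suc r)) (g r) (g (suc r))) (DegreeBelow-∸ d (Δ f) (Δ g) degf degg)
  where
  exchange : ∀ x x′ y y′ → x ℤ.- x′ ℤ.- (y ℤ.- y′) ≡ x ℤ.- y ℤ.- (x′ ℤ.- y′)
  exchange = ℤ-Ring.solve-∀

DegreeBelow-suc : ∀ d f → DegreeBelow d f → DegreeBelow d (λ r → f (suc r))
DegreeBelow-suc zero    f f≡0 r = f≡0 (suc r)
DegreeBelow-suc (suc d) f deg   = DegreeBelow-suc d (Δ f) deg

-- Discrete Leibniz rule: the difference of (s + r) f(r) is (s + r) Δf(r) - f(r+1). The first part
-- is covered by induction, the second is a shift of `f`.
DegreeBelow-linear : ∀ d s {f} → DegreeBelow d f → DegreeBelow (suc d) (λ r → + (s + r) ℤ.* f r)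
DegreeBelow-linear zero    s f≡0 r rewrite f≡0 r | f≡0 (suc r) | ℤₚ.*-zeroʳ (+ (s + r)) | ℤₚ.*-zeroʳ (+ (s + suc r)) = refl
DegreeBelow-linear (suc d) s {f} deg =
  DegreeBelow-cong (suc d) leibniz (DegreeBelow-∸ (suc d) (λ r → + (s + r) ℤ.* Δ f r) (λ r → f (suc r))
    (DegreeBelow-linear d s deg) (DegreeBelow-suc (suc d) f deg))
  where
  expand : ∀ x y y′ → x ℤ.* (y ℤ.- y′) ℤ.- y′ ≡ x ℤ.* y ℤ.- (1ℤ ℤ.+ x) ℤ.* y′
  expand = ℤ-Ring.solve-∀
  leibniz : ∀ r → + (s + r) ℤ.* Δ f r ℤ.- f (suc r) ≡ Δ (λ r → + (s + r) ℤ.* f r) r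
  leibniz r rewrite +-suc s r = expand (+ (s + r)) (f r) (f (suc r))

DegreeBelow⇒Δ^≡0 : ∀ m f → DegreeBelow m f → Δ^ m at0 f ≡ 0ℤ
DegreeBelow⇒Δ^≡0 zero    f f≡0 = f≡0 0
DegreeBelow⇒Δ^≡0 (suc m) f deg = DegreeBelow⇒Δ^≡0 m (Δ f) deg

-- Rising factorials and the terminating Saalschütz sum

rise : ℕ → ℕ → ℕ
rise zero    x = 1
rise (suc l) x = x * rise l (suc x)

-- The definition peels off the smallest factor, this the largest; comparing the two relates
-- `rise l (suc x)` to `rise l x`.
rise-last : ∀ l x → rise (suc l) x ≡ (x + l) * rise l x
rise-last zero    x = cong (_* 1) (sym (+-identityʳ x))
rise-last (suc l) x = begin
  x * rise (suc l) (suc x)            ≡⟨ cong (x *_) (rise-last l (suc x)) ⟩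
  x * (suc (x + l) * rise l (suc x))  ≡⟨ regroup x (suc (x + l)) (rise l (suc x)) ⟩
  suc (x + l) * rise (suc l) x        ≡⟨ cong (_* rise (suc l) x) (+-suc x l) ⟨
  (x + suc l) * rise (suc l) x        ∎
  where
  open ≡-Reasoning
  regroup : ∀ x y z → x * (y * z) ≡ y * (x * z)
  regroup = ℕ-Ring.solve-∀

DegreeBelow-rise : ∀ l d s {f} → DegreeBelow d f → DegreeBelow (l + d) (λ r → + rise l (s + r) ℤ.* f r)
DegreeBelow-rise zero    d s {f} deg = DegreeBelow-cong d (λ r → sym (ℤₚ.*-identityˡ (f r))) deg
DegreeBelow-rise (suc l) d s {f} deg =
  DegreeBelow-cong (suc (l + d)) assoc (DegreeBelow-linear (l + d) s (DegreeBelow-rise l d (suc s) deg))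
  where
  assoc : ∀ r → + (s + r) ℤ.* (+ rise l (suc s + r) ℤ.* f r) ≡ + rise (suc l) (s + r) ℤ.* f r
  assoc r = trans (sym (ℤₚ.*-assoc (+ (s + r)) (+ rise l (suc (s + r))) (f r)))
                  (cong (ℤ._* f r) (sym (pos-* (s + r) (rise l (suc (s + r))))))

-- The terms of the terminating balanced series ₃F₂(-m, c+1, i+L+1; 1, i+1; 1), m = c + L + 1,
-- cleared of denominators; up to a sign and a binomial they are a polynomial of degree m − 1 in r.
saalschützTerm : (c L i r : ℕ) → ℤ
saalschützTerm c L i r =
  signedC (suc (c + L)) r ℤ.* (+ rise c (1 + r) ℤ.* + rise L (suc i + r))

sum-saalschützTerm≡0 : ∀ c L i → sumBelow (suc (suc (c + L))) (saalschützTerm c L i) ≡ 0ℤ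
sum-saalschützTerm≡0 c L i = trans (sum-signedC≡Δ^ (suc (c + L)) P) (DegreeBelow⇒Δ^≡0 (suc (c + L)) P degP)
  where
  P : ℕ → ℤ
  P r = + rise c (1 + r) ℤ.* + rise L (suc i + r)
  deg1 : DegreeBelow (L + 1) (λ r → + rise L (suc i + r))
  -- The constant 1 has zero difference, so its degree is below 1; each rising factorial then adds
  -- its length to the bound.
  deg1 = DegreeBelow-cong (L + 1) (λ r → ℤₚ.*-identityʳ _) (DegreeBelow-rise L 1 (suc i) {λ _ → 1ℤ} (λ _ → refl))
  degP : DegreeBelow (suc (c + L)) P
  degP = subst (λ d → DegreeBelow d P) (trans (cong (_+_ c) (+-comm L 1)) (+-suc c L)) (DegreeBelow-rise c (L + 1) 1 deg1)

-- One factor `suc r` is absorbed by the signed binomial, the other by `rise c`, and `suc i + r` by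
-- `rise L`.
saalschützTerm-step : ∀ c L i r →
  + (suc r * suc r * (suc i + r)) ℤ.* saalschützTerm c L i (suc r) ≡
  (+ r ℤ.- + suc (c + L)) ℤ.* + ((suc r + c) * (suc i + r + L)) ℤ.* saalschützTerm c L i r
saalschützTerm-step c L i r = begin
  + (suc r * suc r * (suc i + r)) ℤ.* (s′ ℤ.* (u′ ℤ.* v′))
    ≡⟨ cong₂ (λ z w → z ℤ.* (s′ ℤ.* (u′ ℤ.* w))) (trans (pos-* (suc r * suc r) (suc i + r)) (cong (ℤ._* y) (pos-* (suc r) (suc r))))
         (cong (λ t → + rise L t) (cong suc (+-suc i r))) ⟩
  x ℤ.* x ℤ.* y ℤ.* (s′ ℤ.* (u′ ℤ.* + rise L (suc (suc i + r))))
    ≡⟨ distribute x y s′ u′ (+ rise L (suc (suc i + r))) ⟩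
  (x ℤ.* s′) ℤ.* ((x ℤ.* u′) ℤ.* (y ℤ.* + rise L (suc (suc i + r))))
    ≡⟨ cong₂ ℤ._*_ (signedC-step (suc (c + L)) r) (cong₂ ℤ._*_ (shift c (suc r)) (shift L (suc i + r))) ⟩
  e ℤ.* s ℤ.* ((+ (suc r + c) ℤ.* u) ℤ.* (+ (suc i + r + L) ℤ.* v))
    ≡⟨ collect e s (+ (suc r + c)) u (+ (suc i + r + L)) v ⟩
  e ℤ.* (+ (suc r + c) ℤ.* + (suc i + r + L)) ℤ.* (s ℤ.* (u ℤ.* v))
    ≡⟨ cong (λ z → e ℤ.* z ℤ.* (s ℤ.* (u ℤ.* v))) (pos-* (suc r + c) (suc i + r + L)) ⟨
  e ℤ.* + ((suc r + c) * (suc i + r + L)) ℤ.* (s ℤ.* (u ℤ.* v)) ∎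
  where
  open ≡-Reasoning
  x = + suc r
  y = + (suc i + r)
  e = + r ℤ.- + suc (c + L)
  s = signedC (suc (c + L)) r
  s′ = signedC (suc (c + L)) (suc r)
  u = + rise c (suc r)
  u′ = + rise c (suc (suc r))
  v = + rise L (suc i + r)
  v′ = + rise L (suc i + suc r)
  shift : ∀ l x → + x ℤ.* + rise l (suc x) ≡ + (x + l) ℤ.* + rise l x
  shift l x = trans (sym (pos-* x (rise l (suc x)))) (trans (cong +_ (rise-last l x)) (pos-* (x + l) (rise l x)))
  distribute : ∀ x y s u v → x ℤ.* x ℤ.* y ℤ.* (s ℤ.* (u ℤ.* v)) ≡ (x ℤ.* s) ℤ.* ((x ℤ.* u) ℤ.* (y ℤ.* v))
  distribute = ℤ-Ring.solve-∀
  collect : ∀ e s a u b v → e ℤ.* s ℤ.* ((a ℤ.* u) ℤ.* (b ℤ.* v)) ≡ e ℤ.* (a ℤ.* b) ℤ.* (s ℤ.* (u ℤ.* v))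
  collect = ℤ-Ring.solve-∀

-- Carries and binomials divisible by a prime

q*p+t-indivisible : ∀ {p} q {t} → 0 < t → t < p → ¬ (p ∣ₙ q * p + t)
q*p+t-indivisible q {suc t} _ t<p p∣ =
  <⇒≱ t<p (ℕ∣.∣⇒≤ (ℕ∣.∣m+n∣m⇒∣n p∣ (ℕ∣.n∣m*n q)))

-- The carry case of Lucas' theorem.
prime∣binomial : ∀ {p} → Prime p → ∀ A B s t → s < t → t < p → p ∣ₙ ((A * p + s) C (B * p + t))
prime∣binomial {p} pr A B zero (suc t) _ t<p
  rewrite +-identityʳ (A * p) | +-suc (B * p) t = absorb (A * p) (ℕ∣.n∣m*n A)
  where
  absorb : ∀ a → p ∣ₙ a → p ∣ₙ (a C suc (B * p + t))
  absorb zero    p∣a = p ℕ∣.∣0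
  -- Absorption gives b C(a,b) = a C(a-1,b-1); here p divides the upper index but not the lower one.
  absorb (suc a) p∣a with euclidsLemma (suc (B * p + t)) (suc a C suc (B * p + t)) pr
    (subst (p ∣ₙ_) (sym ([k+1]*[n+1]C[k+1]≡[n+1]*nCk a (B * p + t))) (ℕ∣.∣m⇒∣m*n (a C (B * p + t)) p∣a))
  ... | inj₁ p∣b = contradiction (subst (p ∣ₙ_) (sym (+-suc (B * p) t)) p∣b)
                     (q*p+t-indivisible B (s≤s z≤n) t<p)
  ... | inj₂ p∣C = p∣C
-- Pascal's rule lowers the upper digit to `s`; both lower digits `t` and `suc t` still exceed it.
prime∣binomial {p} pr A B (suc s) (suc t) (s≤s s<t) t<p
  rewrite +-suc (A * p) s | +-suc (B * p) t | sym (nCk+nC[k+1]≡[n+1]C[k+1] (A * p + s) (B * p + t)) =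
  ℕ∣.∣m∣n⇒∣m+n
    (prime∣binomial pr A B s t s<t (<-trans (n<1+n t) t<p))
    (subst (λ b → p ∣ₙ ((A * p + s) C b)) (+-suc (B * p) t)
      (prime∣binomial pr A B s (suc t) (m<n⇒m<1+n s<t) t<p))

-- Factorials and ratios of consecutive terms

[k+l]Ck*k!*l!≡[k+l]! : ∀ k l → ((k + l) C k) * (k ! * l !) ≡ (k + l) !
[k+l]Ck*k!*l!≡[k+l]! k l = subst (λ z → ((k + l) C k) * (k ! * z !) ≡ (k + l) !) (m+n∸m≡n k l) main
  where
  k≤k+l = m≤m+n k l
  instance
    _ = m*n≢0 (k !) ((k + l ∸ k) !) {{k !≢0}} {{(k + l ∸ k) !≢0}}
  main : ((k + l) C k) * (k ! * (k + l ∸ k) !) ≡ (k + l) !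
  main = trans (cong (_* (k ! * (k + l ∸ k) !)) (nCk≡n!/k![n-k]! k≤k+l)) (m/n*n≡m (k![n∸k]!∣n! k≤k+l))

-- For 3k + i ≤ N this is N! / (k! k! (k+i)! (N-3k-i)!), as `multinomial-!` confirms.
multinomial : (i N k : ℕ) → ℕ
multinomial i N k = ((3 * k + i) C k) * ((2 * k + i) C k) * (N C (3 * k + i))

multinomial-! : ∀ i k e → multinomial i (3 * k + i + e) k * (k ! * k ! * (k + i) ! * e !) ≡ (3 * k + i + e) !
multinomial-! i k e = begin
  x * y * z * (k ! * k ! * (k + i) ! * e !)
    ≡⟨ regroup x y z (k !) ((k + i) !) (e !) ⟩
  z * (x * (k ! * (y * (k ! * (k + i) !))) * e !)
    ≡⟨ cong (λ w → z * (x * (k ! * w) * e !)) inner ⟩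
  z * (x * (k ! * (2 * k + i) !) * e !)
    ≡⟨ cong (λ w → z * (w * e !)) outer ⟩
  z * ((3 * k + i) ! * e !)
    ≡⟨ [k+l]Ck*k!*l!≡[k+l]! (3 * k + i) e ⟩
  (3 * k + i + e) ! ∎
  where
  open ≡-Reasoning
  x = (3 * k + i) C k
  y = (2 * k + i) C k
  z = (3 * k + i + e) C (3 * k + i)
  regroup : ∀ x y z u v w → x * y * z * (u * u * v * w) ≡ z * (x * (u * (y * (u * v))) * w)
  regroup = ℕ-Ring.solve-∀
  two : ∀ k i → k + (k + i) ≡ 2 * k + i
  two = ℕ-Ring.solve-∀
  three : ∀ k i → k + (2 * k + i) ≡ 3 * k + i
  three = ℕ-Ring.solve-∀
  inner : y * (k ! * (k + i) !) ≡ (2 * k + i) !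
  inner = subst (λ a → (a C k) * (k ! * (k + i) !) ≡ a !) (two k i) ([k+l]Ck*k!*l!≡[k+l]! k (k + i))
  outer : x * (k ! * (2 * k + i) !) ≡ (3 * k + i) !
  outer = subst (λ a → (a C k) * (k ! * (2 * k + i) !) ≡ a !) (three k i) ([k+l]Ck*k!*l!≡[k+l]! k (2 * k + i))

3k+i+[3+e]≡3[1+k]+i+e : ∀ k i e → 3 * k + i + (3 + e) ≡ 3 * suc k + i + e
3k+i+[3+e]≡3[1+k]+i+e = ℕ-Ring.solve-∀

-- After multiplication by `Z` both sides equal N!, by the factorial formula at k + 1 and at k.
-- Writing N as 3k + i + (3 + e) keeps every factorial free of truncated subtraction.
multinomial-step : ∀ i k e → let N = 3 * k + i + (3 + e) in
  suc k * suc k * (suc k + i) * multinomial i N (suc k) ≡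
  (3 + e) * (2 + e) * (1 + e) * multinomial i N k
multinomial-step i k e = *-cancelʳ-≡ _ _ Z (begin
  suc k * suc k * (suc k + i) * multinomial i N (suc k) * Z
    ≡⟨ regroup′ (suc k) (suc k + i) (multinomial i N (suc k)) (k !) ((k + i) !) (e !) ⟩
  multinomial i N (suc k) * (suc k ! * suc k ! * (suc k + i) ! * e !)
    ≡⟨ cong (λ n → multinomial i n (suc k) * (suc k ! * suc k ! * (suc k + i) ! * e !)) (3k+i+[3+e]≡3[1+k]+i+e k i e) ⟩
  multinomial i (3 * suc k + i + e) (suc k) * (suc k ! * suc k ! * (suc k + i) ! * e !)
    ≡⟨ multinomial-! i (suc k) e ⟩
  (3 * suc k + i + e) !
    ≡⟨ cong _! (3k+i+[3+e]≡3[1+k]+i+e k i e) ⟨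
  N !
    ≡⟨ multinomial-! i k (3 + e) ⟨
  multinomial i N k * (k ! * k ! * (k + i) ! * (3 + e) !)
    ≡⟨ regroup (multinomial i N k) (k !) ((k + i) !) (e !) (3 + e) (2 + e) (1 + e) ⟩
  (3 + e) * (2 + e) * (1 + e) * multinomial i N k * Z ∎)
  where
  open ≡-Reasoning
  N = 3 * k + i + (3 + e)
  Z = k ! * k ! * (k + i) ! * e !
  instance
    _ = k !≢0
    _ = (k + i) !≢0
    _ = e !≢0
    _ = m*n≢0 (k !) (k !)
    _ = m*n≢0 (k ! * k !) ((k + i) !)
    _ = m*n≢0 (k ! * k ! * (k + i) !) (e !)
  regroup′ : ∀ x y m a b c → x * x * y * m * (a * a * b * c) ≡ m * ((x * a) * (x * a) * (y * b) * c)
  regroup′ = ℕ-Ring.solve-∀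
  regroup : ∀ m a b c x y z → m * (a * a * b * (x * (y * (z * c)))) ≡ x * y * z * m * (a * a * b * c)
  regroup = ℕ-Ring.solve-∀

∣aTerm∣ : (i N k : ℕ) → ℕ
∣aTerm∣ i N k = multinomial i N k * ((N + k) C k) * 3 ^ (N ∸ (3 * k + i))

-- Beyond `multinomial-step`, absorption in C(N+k,k) supplies the third factor k + 1, and the drop
-- of the exponent of 3 by three supplies 27.
∣aTerm∣-step : ∀ i k e → let N = 3 * k + i + (3 + e) in
  27 * (suc k * suc k * suc k) * (suc k + i) * ∣aTerm∣ i N (suc k) ≡
  (3 + e) * (2 + e) * (1 + e) * (N + suc k) * ∣aTerm∣ i N k
∣aTerm∣-step i k e = begin
  27 * (suc k * suc k * suc k) * (suc k + i) * (M′ * ((N + suc k) C suc k) * 3 ^ (N ∸ (3 * suc k + i)))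
    ≡⟨ cong₂ (λ u v → 27 * (suc k * suc k * suc k) * (suc k + i) * (M′ * (u C suc k) * 3 ^ v)) (+-suc N k)
         (trans (cong (_∸ (3 * suc k + i)) (3k+i+[3+e]≡3[1+k]+i+e k i e)) (m+n∸m≡n (3 * suc k + i) e)) ⟩
  27 * (suc k * suc k * suc k) * (suc k + i) * (M′ * (suc (N + k) C suc k) * 3 ^ e)
    ≡⟨ distribute (suc k) (suc k + i) M′ (suc (N + k) C suc k) (3 ^ e) ⟩
  27 * 3 ^ e * (suc k * (suc (N + k) C suc k)) * (suc k * suc k * (suc k + i) * M′)
    ≡⟨ cong₂ (λ u v → 27 * 3 ^ e * u * v)
         ([k+1]*[n+1]C[k+1]≡[n+1]*nCk (N + k) k) (multinomial-step i k e) ⟩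
  27 * 3 ^ e * (suc (N + k) * ((N + k) C k)) * ((3 + e) * (2 + e) * (1 + e) * M)
    ≡⟨ collect (suc (N + k)) ((3 + e) * (2 + e) * (1 + e)) M ((N + k) C k) (3 ^ e) ⟩
  (3 + e) * (2 + e) * (1 + e) * suc (N + k) * (M * ((N + k) C k) * 3 ^ (3 + e))
    ≡⟨ cong₂ (λ u v → (3 + e) * (2 + e) * (1 + e) * u * (M * ((N + k) C k) * 3 ^ v)) (sym (+-suc N k))
         (sym (m+n∸m≡n (3 * k + i) (3 + e))) ⟩
  (3 + e) * (2 + e) * (1 + e) * (N + suc k) * ∣aTerm∣ i N k ∎
  where
  open ≡-Reasoning
  N = 3 * k + i + (3 + e)
  M = multinomial i N k
  M′ = multinomial i N (suc k)
  distribute : ∀ x y m g t → 27 * (x * x * x) * y * (m * g * t) ≡ 27 * t * (x * g) * (x * x * y * m)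
  distribute = ℕ-Ring.solve-∀
  collect : ∀ h f m g t → 27 * t * (h * g) * (f * m) ≡ f * h * (m * g * (3 * (3 * (3 * t))))
  collect = ℕ-Ring.solve-∀

aTerm≡0 : ∀ i N k → N < 3 * k + i → aTerm i N k ≡ 0ℤ
aTerm≡0 i N k N<3k+i rewrite k>n⇒nCk≡0 N<3k+i | *-zeroʳ (((3 * k + i) C k) * ((2 * k + i) C k)) =
  ℤₚ.*-zeroʳ (-1ℤ ℤ.^ (N ∸ k))

denominator : (i k : ℕ) → ℕ
denominator i k = 27 * (suc k * suc k * suc k) * (suc k + i)

-- With `t` = 3k + i - N in place of N - 3k - i, the three reversed signs account for the
-- alternating sign of the terms.
numerator : (i N k : ℕ) → ℤ
numerator i N k = t ℤ.* (1ℤ ℤ.+ t) ℤ.* (+ 2 ℤ.+ t) ℤ.* + (N + suc k)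
  where
  t = + (3 * k + i) ℤ.- + N

m-[m+n]≡-n : ∀ m n → + m ℤ.- + (m + n) ≡ ℤ.- + n
m-[m+n]≡-n m n rewrite pos-+ m n = cancel (+ m) (+ n)
  where
  cancel : ∀ x y → x ℤ.- (x ℤ.+ y) ≡ ℤ.- y
  cancel = ℤ-Ring.solve-∀

-- The blocks run past the support, so every k is covered. If 3k + i > N both terms vanish; if N -
-- 3k - i is 0, 1 or 2 the numerator has a zero factor and the next term vanishes; otherwise this is
-- `∣aTerm∣-step` with signs.
aTerm-step : ∀ i N k → 1 ≤ i → + denominator i k ℤ.* aTerm i N (suc k) ≡ numerator i N k ℤ.* aTerm i N k
aTerm-step i N k 1≤i with 3 * k + i ≤? N
... | no 3k+i≰N
  rewrite aTerm≡0 i N k (≰⇒> 3k+i≰N)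
        | aTerm≡0 i N (suc k) (<-≤-trans (≰⇒> 3k+i≰N) (+-monoˡ-≤ i (*-monoʳ-≤ 3 (n≤1+n k)))) =
  trans (ℤₚ.*-zeroʳ (+ denominator i k)) (sym (ℤₚ.*-zeroʳ (numerator i N k)))
... | yes 3k+i≤N with m≤n⇒∃[o]m+o≡n 3k+i≤N
...   | e , refl = split e
  where
  vanish : ∀ e → e < 3 → numerator i (3 * k + i + e) k ≡ 0ℤ →
    + denominator i k ℤ.* aTerm i (3 * k + i + e) (suc k) ≡
    numerator i (3 * k + i + e) k ℤ.* aTerm i (3 * k + i + e) k
  vanish e e<3 num≡0 rewrite num≡0 =
    trans (cong (+ denominator i k ℤ.*_) (aTerm≡0 i (3 * k + i + e) (suc k)
             (subst (3 * k + i + e <_) (trans (3k+i+[3+e]≡3[1+k]+i+e k i 0) (+-identityʳ (3 * suc k + i)))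
               (+-monoʳ-< (3 * k + i) e<3))))
          (ℤₚ.*-zeroʳ (+ denominator i k))
  split : ∀ e → + denominator i k ℤ.* aTerm i (3 * k + i + e) (suc k) ≡
                numerator i (3 * k + i + e) k ℤ.* aTerm i (3 * k + i + e) k
  split 0 = vanish 0 (s≤s z≤n) eq
    where
    eq : numerator i (3 * k + i + 0) k ≡ 0ℤ
    eq rewrite m-[m+n]≡-n (3 * k + i) 0 = refl
  split 1 = vanish 1 (s≤s (s≤s z≤n)) eq
    where
    eq : numerator i (3 * k + i + 1) k ≡ 0ℤ
    eq rewrite m-[m+n]≡-n (3 * k + i) 1 = refl
  split 2 = vanish 2 (s≤s (s≤s (s≤s z≤n))) eq
    where
    eq : numerator i (3 * k + i + 2) k ≡ 0ℤ
    eq rewrite m-[m+n]≡-n (3 * k + i) 2 = refl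
  split (suc (suc (suc e))) = begin
    + d ℤ.* (s ℤ.* + y′)                      ≡⟨ swap (+ d) s (+ y′) ⟩
    s ℤ.* (+ d ℤ.* + y′)                      ≡⟨ cong (s ℤ.*_) (trans (sym (pos-* d y′))
                                                   (trans (cong +_ (∣aTerm∣-step i k e)) (pos-* (f * h) y))) ⟩
    s ℤ.* (+ (f * h) ℤ.* + y)                 ≡⟨ cong (λ w → s ℤ.* (w ℤ.* + y)) numerator′ ⟩
    s ℤ.* (ℤ.- numerator i n k ℤ.* + y)       ≡⟨ negate s (numerator i n k) (+ y) ⟩
    numerator i n k ℤ.* (-1ℤ ℤ.* s ℤ.* + y)   ≡⟨ cong (λ w → numerator i n k ℤ.* ((-1ℤ ℤ.^ w) ℤ.* + y)) (+-∸-assoc 1 k<n) ⟨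
    numerator i n k ℤ.* aTerm i n k           ∎
    where
    open ≡-Reasoning
    n = 3 * k + i + (3 + e)
    d = denominator i k
    y = ∣aTerm∣ i n k
    y′ = ∣aTerm∣ i n (suc k)
    s = -1ℤ ℤ.^ (n ∸ suc k)
    f = (3 + e) * (2 + e) * (1 + e)
    h = n + suc k
    -- Ensures that `n ∸ k` is exactly one more than `n ∸ suc k`, so the sign really flips.
    k<n : k < n
    k<n = <-≤-trans (subst (_< 3 * k + i) (+-identityʳ k) (+-mono-≤-< (m≤n*m k 3) 1≤i)) (m≤m+n (3 * k + i) (3 + e))
    swap : ∀ x y z → x ℤ.* (y ℤ.* z) ≡ y ℤ.* (x ℤ.* z)
    swap = ℤ-Ring.solve-∀
    negate : ∀ s x y → s ℤ.* (ℤ.- x ℤ.* y) ≡ x ℤ.* (-1ℤ ℤ.* s ℤ.* y)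
    negate = ℤ-Ring.solve-∀
    expand : ∀ e h → (+ 3 ℤ.+ e) ℤ.* (+ 2 ℤ.+ e) ℤ.* (+ 1 ℤ.+ e) ℤ.* h ≡
      ℤ.- (ℤ.- (+ 3 ℤ.+ e) ℤ.* (1ℤ ℤ.+ ℤ.- (+ 3 ℤ.+ e)) ℤ.* (+ 2 ℤ.+ ℤ.- (+ 3 ℤ.+ e)) ℤ.* h)
    expand = ℤ-Ring.solve-∀
    numerator′ : + (f * h) ≡ ℤ.- numerator i n k
    numerator′ rewrite m-[m+n]≡-n (3 * k + i) (3 + e) = begin
      + (f * h)           ≡⟨ pos-* f h ⟩
      + f ℤ.* + h         ≡⟨ cong (ℤ._* + h) (pos-* ((3 + e) * (2 + e)) (1 + e)) ⟩
      + ((3 + e) * (2 + e)) ℤ.* + (1 + e) ℤ.* + h ≡⟨ cong (λ w → w ℤ.* + (1 + e) ℤ.* + h) (pos-* (3 + e) (2 + e)) ⟩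
      + (3 + e) ℤ.* + (2 + e) ℤ.* + (1 + e) ℤ.* + h ≡⟨ expand (+ e) (+ h) ⟩
      _ ∎

-- Residues of the hypergeometric parameters

-- With m = suc (c + L), the parameters i/3, (i+1)/3, (i+2)/3 of the hypergeometric series are,
-- modulo p and in some order, −m, c + 1 and i + L + 1.
record Residues (p i : ℕ) : Set where
  field
    c L j j′ j″ : ℕ
    p≡          : p ≡ 3 * suc (c + L) + i + j
    c≡          : i + j′ ≡ 3 * suc c
    L≡          : 3 * (suc i + L) ≡ i + j″ + p
    factors     : ∀ t → t ℤ.* (1ℤ ℤ.+ t) ℤ.* (+ 2 ℤ.+ t) ≡ (+ j ℤ.+ t) ℤ.* (+ j′ ℤ.+ t) ℤ.* (+ j″ ℤ.+ t)

-- Write i - 1 = t + 3c and p - i = j + 3m. Then j′ = 2 - t makes i + j′ divisible by 3, and j″ is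
-- the remaining element of 0, 1, 2. This needs j and j′ distinct, which 3 ∤ p guarantees, and c <
-- m, so that L = m - c - 1 exists.
residues : ∀ p i → 3 * i < p → 1 ≤ i → ¬ (3 ∣ₙ p) → Residues p i
residues p (suc i′) 3i<p _ 3∤p with i′ divMod 3 | (p ∸ suc i′) divMod 3
... | result c t i′≡ | result m j p∸i≡ = build t j i′≡ p≡i+j+3m
  where
  i = suc i′
  i<p : i < p
  i<p = ≤-<-trans (m≤n*m i 3) 3i<p
  p≡i+j+3m : p ≡ i + (toℕ j + m * 3)
  p≡i+j+3m = trans (sym (m+[n∸m]≡n (<⇒≤ i<p))) (cong (_+_ i) p∸i≡)
  -- Here 3i = i + 2 + 2i′ and p is at most i + 2 + 3m, so 3i < p gives 2i′ < 3m, while 3c is at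
  -- most i′.
  c<m : ∀ {t j} → j ≤ 2 → i′ ≡ t + c * 3 → p ≡ i + (j + m * 3) → c < m
  c<m {t} {j} j≤2 i′≡ p≡ = *-cancelʳ-< 3 c m (begin-strict
    c * 3     ≤⟨ m≤n+m (c * 3) t ⟩
    t + c * 3 ≡⟨ i′≡ ⟨
    i′        ≤⟨ m≤n+m i′ i′ ⟩
    i′ + i′   <⟨ +-cancelˡ-< (i + 2) _ _ key ⟩
    m * 3     ∎)
    where
    open ≤-Reasoning
    triple : ∀ i′ → suc i′ + 2 + (i′ + i′) ≡ 3 * suc i′
    triple = ℕ-Ring.solve-∀
    key : i + 2 + (i′ + i′) < i + 2 + m * 3
    key = begin-strict
      i + 2 + (i′ + i′)  ≡⟨ triple i′ ⟩
      3 * i              <⟨ 3i<p ⟩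
      p                  ≡⟨ p≡ ⟩
      i + (j + m * 3)    ≤⟨ +-monoʳ-≤ i (+-monoˡ-≤ (m * 3) j≤2) ⟩
      i + (2 + m * 3)    ≡⟨ +-assoc i 2 (m * 3) ⟨
      i + 2 + m * 3      ∎
  make : ∀ t j j′ j″ → j ≤ 2 → t + j′ ≡ 2 → j + j″ ≡ suc t →
    (∀ t → t ℤ.* (1ℤ ℤ.+ t) ℤ.* (+ 2 ℤ.+ t) ≡ (+ j ℤ.+ t) ℤ.* (+ j′ ℤ.+ t) ℤ.* (+ j″ ℤ.+ t)) →
    i′ ≡ t + c * 3 → p ≡ i + (j + m * 3) → Residues p i
  make t j j′ j″ j≤2 t+j′≡2 j+j″≡1+t factors i′≡ p≡ with m≤n⇒∃[o]m+o≡n (c<m j≤2 i′≡ p≡)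
  ... | L , m≡ = record
    { c = c ; L = L ; j = j ; j′ = j′ ; j″ = j″
    ; p≡ = p≡′
    ; c≡ = begin
        suc i′ + j′             ≡⟨ cong (λ x → suc x + j′) i′≡ ⟩
        suc (t + c * 3) + j′    ≡⟨ gather t c j′ ⟩
        t + j′ + suc (c * 3)    ≡⟨ cong (_+ suc (c * 3)) t+j′≡2 ⟩
        2 + suc (c * 3)         ≡⟨ *-comm (suc c) 3 ⟩
        3 * suc c               ∎
    ; L≡ = begin
        3 * (suc i + L)                              ≡⟨ spread i L ⟩
        i + 3 * suc L + (i + i)                      ≡⟨ cong (λ x → i + 3 * suc L + (i + x)) i≡ ⟩
        i + 3 * suc L + (i + (j + j″ + c * 3))       ≡⟨ collect i j j″ c L ⟩
        i + j″ + (3 * suc (c + L) + i + j)           ≡⟨ cong (_+_ (i + j″)) p≡′ ⟨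
        i + j″ + p                                   ∎
    ; factors = factors }
    where
    open ≡-Reasoning
    i≡ : i ≡ j + j″ + c * 3
    i≡ = trans (cong suc i′≡) (cong (_+ c * 3) (sym j+j″≡1+t))
    swap : ∀ i j x → i + (j + x * 3) ≡ 3 * x + i + j
    swap = ℕ-Ring.solve-∀
    p≡′ : p ≡ 3 * suc (c + L) + i + j
    p≡′ = trans p≡ (trans (cong (λ x → i + (j + x * 3)) (sym m≡)) (swap i j (suc (c + L))))
    gather : ∀ t c j′ → suc (t + c * 3) + j′ ≡ t + j′ + suc (c * 3)
    gather = ℕ-Ring.solve-∀
    spread : ∀ i L → 3 * (suc i + L) ≡ i + 3 * suc L + (i + i)
    spread = ℕ-Ring.solve-∀
    collect : ∀ i j j″ c L → i + 3 * suc L + (i + (j + j″ + c * 3)) ≡ i + j″ + (3 * suc (c + L) + i + j)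
    collect = ℕ-Ring.solve-∀
  -- This is the case j = j′: 3 divides i + j, hence also p = 3m + i + j.
  impossible : ∀ t j → t + j ≡ 2 → i′ ≡ t + c * 3 → p ≡ i + (j + m * 3) → Residues p i
  impossible t j t+j≡2 i′≡ p≡ = contradiction (ℕ∣.divides (suc (c + m)) 3∣p) 3∤p
    where
    open ≡-Reasoning
    gather : ∀ t j c m → suc (t + c * 3) + (j + m * 3) ≡ (t + j) + (suc (c * 3) + m * 3)
    gather = ℕ-Ring.solve-∀
    three : ∀ c m → 2 + (suc (c * 3) + m * 3) ≡ suc (c + m) * 3
    three = ℕ-Ring.solve-∀
    3∣p : p ≡ suc (c + m) * 3
    3∣p = begin
      p                                   ≡⟨ p≡ ⟩
      suc i′ + (j + m * 3)                ≡⟨ cong (λ x → suc x + (j + m * 3)) i′≡ ⟩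
      suc (t + c * 3) + (j + m * 3)       ≡⟨ gather t j c m ⟩
      (t + j) + (suc (c * 3) + m * 3)     ≡⟨ cong (_+ (suc (c * 3) + m * 3)) t+j≡2 ⟩
      2 + (suc (c * 3) + m * 3)           ≡⟨ three c m ⟩
      suc (c + m) * 3                     ∎
  build : ∀ (t j : Fin 3) → i′ ≡ toℕ t + c * 3 → p ≡ i + (toℕ j + m * 3) → Residues p i
  build 0F 0F = make 0 0 2 1 z≤n refl refl ℤ-Ring.solve-∀
  build 0F 1F = make 0 1 2 0 (s≤s z≤n) refl refl ℤ-Ring.solve-∀
  build 0F 2F = impossible 0 2 refl
  build 1F 0F = make 1 0 1 2 z≤n refl refl ℤ-Ring.solve-∀
  build 1F 1F = impossible 1 1 refl
  build 1F 2F = make 1 2 1 0 ≤-refl refl refl ℤ-Ring.solve-∀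
  build 2F 0F = impossible 2 0 refl
  build 2F 1F = make 2 1 0 2 (s≤s z≤n) refl refl ℤ-Ring.solve-∀
  build 2F 2F = make 2 2 0 1 ≤-refl refl refl ℤ-Ring.solve-∀

-- Cancellation modulo prime powers, congruences modulo p

p^e∣d*m⇒p^e∣m : ∀ {p} → Prime p → ∀ e {d m} → ¬ (p ∣ₙ d) → p ^ e ∣ₙ d * m → p ^ e ∣ₙ m
p^e∣d*m⇒p^e∣m pr zero p∤d _ = ℕ∣.1∣ _
p^e∣d*m⇒p^e∣m {p} pr (suc e) {d} {m} p∤d p^[1+e]∣dm
  with euclidsLemma d m pr (ℕ∣.∣-trans (ℕ∣.m∣m*n (p ^ e)) p^[1+e]∣dm)
... | inj₁ p∣d = contradiction p∣d p∤d
... | inj₂ (ℕ∣.divides m′ refl) =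
  subst (p * p ^ e ∣ₙ_) (*-comm p m′) (ℕ∣.*-monoʳ-∣ p (p^e∣d*m⇒p^e∣m pr e p∤d
    (ℕ∣.*-cancelˡ-∣ p (subst (p * p ^ e ∣ₙ_) (regroup d m′ p) p^[1+e]∣dm))))
  where
  instance _ = prime⇒nonZero pr
  regroup : ∀ d m p → d * (m * p) ≡ p * (d * m)
  regroup = ℕ-Ring.solve-∀

p^e∣+d*x⇒p^e∣x : ∀ {p} → Prime p → ∀ e d {x} → ¬ (p ∣ₙ d) → + (p ^ e) ∣ₛ + d ℤ.* x → + (p ^ e) ∣ₛ x
p^e∣+d*x⇒p^e∣x {p} pr e d {x} p∤d p^e∣dx =
  ℤ∣.∣ᵤ⇒∣ (p^e∣d*m⇒p^e∣m pr e p∤d (subst (p ^ e ∣ₙ_) (ℤₚ.abs-* (+ d) x) (ℤ∣.∣⇒∣ᵤ p^e∣dx)))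

p∣a∧p∣b⇒p²∣a*b : ∀ p {a b} → + p ∣ₛ a → + p ∣ₛ b → + (p ^ 2) ∣ₛ a ℤ.* b
p∣a∧p∣b⇒p²∣a*b p (ℤ∣.divides u refl) (ℤ∣.divides v refl) =
  ℤ∣.divides (u ℤ.* v) (trans (regroup u v (+ p))
    (cong (u ℤ.* v ℤ.*_) (trans (sym (pos-* p p)) (cong (λ x → + (p * x)) (sym (*-identityʳ p))))))
  where
  regroup : ∀ u v x → u ℤ.* x ℤ.* (v ℤ.* x) ≡ u ℤ.* v ℤ.* (x ℤ.* x)
  regroup = ℤ-Ring.solve-∀

infix 4 _≡[_]_

-- A record, so that both sides can be inferred from a congruence; their difference alone would not
-- determine them.
record _≡[_]_ (a : ℤ) (p : ℕ) (b : ℤ) : Set where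
  constructor congruent
  field difference : + p ∣ₛ a ℤ.- b

open _≡[_]_

mod-refl : ∀ {p a} → a ≡[ p ] a
mod-refl {p} {a} = congruent (ℤ∣.divides 0ℤ (ℤₚ.+-inverseʳ a))

mod-trans : ∀ {p a b c} → a ≡[ p ] b → b ≡[ p ] c → a ≡[ p ] c
mod-trans {p} {a} {b} {c} (congruent p∣a-b) (congruent p∣b-c) =
  congruent (subst (+ p ∣ₛ_) (telescope a b c) (ℤ∣.∣m∣n⇒∣m+n p∣a-b p∣b-c))
  where
  telescope : ∀ a b c → a ℤ.- b ℤ.+ (b ℤ.- c) ≡ a ℤ.- c
  telescope = ℤ-Ring.solve-∀

mod-+ : ∀ {p a b} c → a ≡[ p ] b → c ℤ.+ a ≡[ p ] c ℤ.+ b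
mod-+ {p} {a} {b} c (congruent p∣a-b) = congruent (subst (+ p ∣ₛ_) (cancel a b c) p∣a-b)
  where
  cancel : ∀ a b c → a ℤ.- b ≡ c ℤ.+ a ℤ.- (c ℤ.+ b)
  cancel = ℤ-Ring.solve-∀

mod-* : ∀ {p a b c d} → a ≡[ p ] b → c ≡[ p ] d → a ℤ.* c ≡[ p ] b ℤ.* d
mod-* {p} {a} {b} {c} {d} (congruent p∣a-b) (congruent p∣c-d) =
  congruent (subst (+ p ∣ₛ_) (expand a b c d) (ℤ∣.∣m∣n⇒∣m+n (ℤ∣.∣n⇒∣m*n a p∣c-d) (ℤ∣.∣m⇒∣m*n d p∣a-b)))
  where
  expand : ∀ a b c d → a ℤ.* (c ℤ.- d) ℤ.+ (a ℤ.- b) ℤ.* d ≡ a ℤ.* c ℤ.- b ℤ.* d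
  expand = ℤ-Ring.solve-∀

[q*p+r]≡r : ∀ p q r → + (q * p + r) ≡[ p ] + r
[q*p+r]≡r p q r = congruent (ℤ∣.divides (+ q) (begin
  + (q * p + r) ℤ.- + r       ≡⟨ cong (ℤ._- + r) (pos-+ (q * p) r) ⟩
  + (q * p) ℤ.+ + r ℤ.- + r   ≡⟨ cancel (+ (q * p)) (+ r) ⟩
  + (q * p)                   ≡⟨ pos-* q p ⟩
  + q ℤ.* + p                 ∎))
  where
  open ≡-Reasoning
  cancel : ∀ x y → x ℤ.+ y ℤ.- y ≡ x
  cancel = ℤ-Ring.solve-∀

-- All factors lie between 1 and p - 1.
p∤rise : ∀ {p} → Prime p → ∀ l x → 1 ≤ x → x + l ≤ p → ¬ (p ∣ₙ rise l x)
p∤rise {p} pr zero    x 1≤x x+l≤p p∣1 = ℕ∣.>⇒∤ (nonTrivial⇒n>1 p {{prime⇒nonTrivial pr}}) p∣1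
p∤rise {p} pr (suc l) x 1≤x x+l≤p p∣ with euclidsLemma x (rise l (suc x)) pr p∣
... | inj₁ p∣x    = q*p+t-indivisible 0 1≤x (<-≤-trans (m<m+n x (s≤s z≤n)) x+l≤p) p∣x
... | inj₂ p∣rise = p∤rise pr l (suc x) (s≤s z≤n) (subst (_≤ p) (+-suc x l) x+l≤p) p∣rise

-- A block of p consecutive terms modulo p²

module Block {p i : ℕ} (pr : Prime p) (5≤p : 5 ≤ p) (1≤i : 1 ≤ i) (3i<p : 3 * i < p)
             (R : Residues p i) (n q : ℕ) where
  open Residues R

  m z : ℕ
  m = suc (c + L)
  -- Written as an offset from `suc m`, so that `suc m + t` with t at most 2(c + L) + j runs exactly
  -- over the range from m + 1 to `z`.
  z = suc m + (2 * (c + L) + j)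

  -- z = p − i − 1
  z+i≡ : suc z + i ≡ p
  z+i≡ = trans (regroup (c + L) j i) (sym p≡)
    where
    regroup : ∀ x j i → suc (suc (suc x) + (2 * x + j)) + i ≡ 3 * suc x + i + j
    regroup = ℕ-Ring.solve-∀

  m<z : m < z
  m<z = m≤m+n (suc m) _

  term : ℕ → ℤ
  term r = aTerm i (n * p) (q * p + r)

  p∤3 : ¬ (p ∣ₙ 3)
  p∤3 = ℕ∣.>⇒∤ (<-≤-trans (n<1+n 3) (<⇒≤ 5≤p))

  p∤27 : ¬ (p ∣ₙ 27)
  p∤27 p∣27 with euclidsLemma 3 9 pr p∣27
  ... | inj₁ p∣3 = p∤3 p∣3
  ... | inj₂ p∣9 with euclidsLemma 3 3 pr p∣9
  ...   | inj₁ p∣3 = p∤3 p∣3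
  ...   | inj₂ p∣3 = p∤3 p∣3

  p∤denominator : ∀ k → ¬ (p ∣ₙ suc k) → ¬ (p ∣ₙ suc k + i) → ¬ (p ∣ₙ denominator i k)
  p∤denominator k p∤1+k p∤1+k+i p∣
    with euclidsLemma (27 * (suc k * suc k * suc k)) (suc k + i) pr p∣
  ... | inj₂ p∣1+k+i = p∤1+k+i p∣1+k+i
  ... | inj₁ p∣27k³ with euclidsLemma 27 (suc k * suc k * suc k) pr p∣27k³
  ...   | inj₁ p∣27 = p∤27 p∣27
  ...   | inj₂ p∣k³ with euclidsLemma (suc k * suc k) (suc k) pr p∣k³
  ...     | inj₂ p∣k = p∤1+k p∣k
  ...     | inj₁ p∣k² with euclidsLemma (suc k) (suc k) pr p∣k²
  ...       | inj₁ p∣k = p∤1+k p∣k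
  ...       | inj₂ p∣k = p∤1+k p∣k

  -- Before `z`, both `suc r` and `suc r + i` stay below p; at r = `z` the latter reaches p.
  p∤denominator-low : ∀ r → r < z → ¬ (p ∣ₙ denominator i (q * p + r))
  p∤denominator-low r r<z = p∤denominator (q * p + r)
    (λ p∣ → q*p+t-indivisible q (s≤s z≤n) (≤-<-trans (m≤m+n (suc r) i) 1+r+i<p) (subst (p ∣ₙ_) (sym (+-suc (q * p) r)) p∣))
    (λ p∣ → q*p+t-indivisible q (s≤s z≤n) 1+r+i<p (subst (p ∣ₙ_) (regroup (q * p) r i) p∣))
    where
    1+r+i<p : suc r + i < p
    1+r+i<p = subst (suc (suc r + i) ≤_) z+i≡ (s≤s (+-monoˡ-≤ i r<z))
    regroup : ∀ x r i → suc (x + r) + i ≡ x + (suc r + i)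
    regroup = ℕ-Ring.solve-∀

  -- Beyond `z` the factor k + 1 + i has wrapped into the next block, where its residue is `suc r`,
  -- again nonzero.
  p∤denominator-high : ∀ r → suc r < i → ¬ (p ∣ₙ denominator i (q * p + (suc z + r)))
  p∤denominator-high r 1+r<i = p∤denominator (q * p + (suc z + r))
    (λ p∣ → q*p+t-indivisible q (s≤s z≤n) 1+z+r<p (subst (p ∣ₙ_) (sym (+-suc (q * p) (suc z + r))) p∣))
    (λ p∣ → q*p+t-indivisible (suc q) {suc r} (s≤s z≤n) 1+r<p (subst (p ∣ₙ_) eq p∣))
    where
    1+r<p : suc r < p
    1+r<p = <-trans 1+r<i (≤-<-trans (m≤n*m i 3) 3i<p)
    1+z+r<p : suc (suc z + r) < p
    1+z+r<p = subst (_≤ p) (cong suc (+-suc (suc z) r)) (subst (suc z + suc r <_) z+i≡ (+-monoʳ-< (suc z) 1+r<i))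
    regroup : ∀ q p z r i → suc (q * p + (suc z + r)) + i ≡ q * p + (suc z + i) + suc r
    regroup = ℕ-Ring.solve-∀
    eq : suc (q * p + (suc z + r)) + i ≡ suc q * p + suc r
    eq = trans (regroup q p z r i) (cong (_+ suc r) (trans (cong (_+_ (q * p)) z+i≡) (+-comm (q * p) p)))

  term-step : ∀ r → + denominator i (q * p + r) ℤ.* term (suc r) ≡ numerator i (n * p) (q * p + r) ℤ.* term r
  term-step r = subst (λ k → + denominator i (q * p + r) ℤ.* aTerm i (n * p) k ≡ numerator i (n * p) (q * p + r) ℤ.* term r)
    (sym (+-suc (q * p) r)) (aTerm-step i (n * p) (q * p + r) 1≤i)

  ∣-step : ∀ e r → ¬ (p ∣ₙ denominator i (q * p + r)) → + (p ^ e) ∣ₛ term r → + (p ^ e) ∣ₛ term (suc r)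
  ∣-step e r p∤d p^e∣ = p^e∣+d*x⇒p^e∣x pr e (denominator i (q * p + r)) p∤d
    (subst (+ (p ^ e) ∣ₛ_) (sym (term-step r)) (ℤ∣.∣n⇒∣m*n (numerator i (n * p) (q * p + r)) p^e∣))

  ∣-run : ∀ e s t → (∀ u → u < t → ¬ (p ∣ₙ denominator i (q * p + (s + u)))) →
    + (p ^ e) ∣ₛ term s → + (p ^ e) ∣ₛ term (s + t)
  ∣-run e s zero    p∤d p^e∣ = subst (λ r → + (p ^ e) ∣ₛ term r) (sym (+-identityʳ s)) p^e∣
  ∣-run e s (suc t) p∤d p^e∣ = subst (λ r → + (p ^ e) ∣ₛ term r) (sym (+-suc s t))
    (∣-step e (s + t) (p∤d t ≤-refl) (∣-run e s t (λ u u<t → p∤d u (m<n⇒m<1+n u<t)) p^e∣))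

  ∣ₙ⇒∣aTerm : ∀ {d} k → d ∣ₙ ∣aTerm∣ i (n * p) k → + d ∣ₛ aTerm i (n * p) k
  ∣ₙ⇒∣aTerm k d∣ = ℤ∣.∣n⇒∣m*n (-1ℤ ℤ.^ (n * p ∸ k)) (ℤ∣.∣ᵤ⇒∣ d∣)

  i<p : i < p
  i<p = ≤-<-trans (m≤n*m i 3) 3i<p

  -- At k = qp the last base-p digit of 3k + i is i > 0, that of N is 0, so N C (3k + i) carries.
  p∣term[0] : + (p ^ 1) ∣ₛ term 0
  p∣term[0] = subst (λ d → + d ∣ₛ term 0) (sym (*-identityʳ p)) (∣ₙ⇒∣aTerm k
    (ℕ∣.∣m⇒∣m*n (3 ^ (n * p ∸ (3 * k + i))) (ℕ∣.∣m⇒∣m*n ((n * p + k) C k)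
      (ℕ∣.∣n⇒∣m*n (((3 * k + i) C k) * ((2 * k + i) C k)) p∣C))))
    where
    k = q * p + 0
    regroup : ∀ q p i → 3 * q * p + i ≡ 3 * (q * p + 0) + i
    regroup = ℕ-Ring.solve-∀
    p∣C : p ∣ₙ ((n * p) C (3 * k + i))
    p∣C = subst₂ (λ a b → p ∣ₙ (a C b)) (+-identityʳ (n * p)) (regroup q p i)
            (prime∣binomial pr n (3 * q) 0 i 1≤i i<p)

  p∣term : ∀ r → r ≤ z → + p ∣ₛ term r
  p∣term r r≤z = subst (λ d → + d ∣ₛ term r) (*-identityʳ p)
    (∣-run 1 0 r (λ u u<r → p∤denominator-low u (<-≤-trans u<r r≤z)) p∣term[0])

  -- The recurrence cannot be cancelled at r = `z`, so divisibility is read off directly. For k = qp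
  -- + (p - i) the last digit of 3k + i is `w` = p - 2i. It is below the digit p - i of k, so (3k +
  -- i) C k carries, and above the digit 0 of N, so N C (3k + i) carries too.
  p²∣term[p-i] : + (p ^ 2) ∣ₛ term (suc z)
  p²∣term[p-i] = subst (λ d → + d ∣ₛ term (suc z)) (cong (p *_) (sym (*-identityʳ p)))
    (∣ₙ⇒∣aTerm k (ℕ∣.∣m⇒∣m*n (3 ^ (n * p ∸ (3 * k + i))) (ℕ∣.∣m⇒∣m*n ((n * p + k) C k)
      (ℕ∣.*-pres-∣ (ℕ∣.∣m⇒∣m*n ((2 * k + i) C k) p∣C₁) p∣C₂))))
    where
    k = q * p + suc z
    i<1+z : i < suc z
    i<1+z = +-cancelʳ-< i i (suc z) (subst₂ _<_ refl (sym z+i≡) (≤-<-trans (i+i≤3*i i) 3i<p))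
      where
      expand : ∀ i → i + i + i ≡ 3 * i
      expand = ℕ-Ring.solve-∀
      i+i≤3*i : ∀ i → i + i ≤ 3 * i
      i+i≤3*i i = subst (i + i ≤_) (expand i) (m≤m+n (i + i) i)
    w = suc z ∸ i
    i+w≡ : i + w ≡ suc z
    i+w≡ = m+[n∸m]≡n (<⇒≤ i<1+z)
    index : (3 * q + 2) * p + w ≡ 3 * k + i
    index = begin
      (3 * q + 2) * p + w                  ≡⟨ spread q p w ⟩
      3 * (q * p) + (2 * p + w)            ≡⟨ cong (λ x → 3 * (q * p) + (2 * x + w)) z+i≡ ⟨
      3 * (q * p) + (2 * (suc z + i) + w)  ≡⟨ shuffle (q * p) (suc z) i w ⟩
      3 * (q * p) + (2 * suc z + i + (i + w)) ≡⟨ cong (λ x → 3 * (q * p) + (2 * suc z + i + x)) i+w≡ ⟩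
      3 * (q * p) + (2 * suc z + i + suc z)   ≡⟨ gather (q * p) (suc z) i ⟩
      3 * k + i ∎
      where
      open ≡-Reasoning
      spread : ∀ q p w → (3 * q + 2) * p + w ≡ 3 * (q * p) + (2 * p + w)
      spread = ℕ-Ring.solve-∀
      shuffle : ∀ x z i w → 3 * x + (2 * (z + i) + w) ≡ 3 * x + (2 * z + i + (i + w))
      shuffle = ℕ-Ring.solve-∀
      gather : ∀ x z i → 3 * x + (2 * z + i + z) ≡ 3 * (x + z) + i
      gather = ℕ-Ring.solve-∀
    w<1+z : w < suc z
    w<1+z = subst (w <_) i+w≡ (m<n+m w 1≤i)
    1+z<p : suc z < p
    1+z<p = subst (suc z <_) z+i≡ (m<m+n (suc z) 1≤i)
    p∣C₁ : p ∣ₙ ((3 * k + i) C k)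
    p∣C₁ = subst (λ a → p ∣ₙ (a C k)) index (prime∣binomial pr (3 * q + 2) q w (suc z) w<1+z 1+z<p)
    p∣C₂ : p ∣ₙ ((n * p) C (3 * k + i))
    p∣C₂ = subst₂ (λ a b → p ∣ₙ (a C b)) (+-identityʳ (n * p)) index
             (prime∣binomial pr n (3 * q + 2) 0 w (m<n⇒0<n∸m i<1+z) (<-trans w<1+z 1+z<p))

  p²∣term-high : ∀ t → t < i → + (p ^ 2) ∣ₛ term (suc z + t)
  p²∣term-high t t<i = ∣-run 2 (suc z) t (λ u u<t → p∤denominator-high u (≤-<-trans u<t t<i)) p²∣term[p-i]

  argument : ℕ → ℤ
  argument r = + (3 * (q * p + r) + i) ℤ.- + (n * p)

  argument≡ : ∀ r → argument r ≡[ p ] + (3 * r + i)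
  argument≡ r = congruent (ℤ∣.divides (+ (3 * q) ℤ.- + n) (begin
    + (3 * (q * p + r) + i) ℤ.- + (n * p) ℤ.- + (3 * r + i)
      ≡⟨ cong₂ (λ a b → a ℤ.- b ℤ.- + (3 * r + i)) split (pos-* n p) ⟩
    + (3 * q) ℤ.* + p ℤ.+ + (3 * r + i) ℤ.- + n ℤ.* + p ℤ.- + (3 * r + i)
      ≡⟨ collect (+ (3 * q)) (+ p) (+ (3 * r + i)) (+ n) ⟩
    (+ (3 * q) ℤ.- + n) ℤ.* + p ∎))
    where
    open ≡-Reasoning
    expand : ∀ q p r i → 3 * (q * p + r) + i ≡ 3 * q * p + (3 * r + i)
    expand = ℕ-Ring.solve-∀
    collect : ∀ a p t n → a ℤ.* p ℤ.+ t ℤ.- n ℤ.* p ℤ.- t ≡ (a ℤ.- n) ℤ.* p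
    collect = ℤ-Ring.solve-∀
    split : + (3 * (q * p + r) + i) ≡ + (3 * q) ℤ.* + p ℤ.+ + (3 * r + i)
    split = trans (cong +_ (expand q p r i)) (trans (pos-+ (3 * q * p) (3 * r + i)) (cong (ℤ._+ + (3 * r + i)) (pos-* (3 * q) p)))

  +p≡ : + p ≡ + 3 ℤ.* + m ℤ.+ + i ℤ.+ + j
  +p≡ = begin
    + p                              ≡⟨ cong +_ p≡ ⟩
    + (3 * m + i + j)                ≡⟨ pos-+ (3 * m + i) j ⟩
    + (3 * m + i) ℤ.+ + j            ≡⟨ cong (ℤ._+ + j) (pos-+ (3 * m) i) ⟩
    + (3 * m) ℤ.+ + i ℤ.+ + j        ≡⟨ cong (λ x → x ℤ.+ + i ℤ.+ + j) (pos-* 3 m) ⟩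
    + 3 ℤ.* + m ℤ.+ + i ℤ.+ + j      ∎
    where open ≡-Reasoning

  +[3r+i] : ∀ r → + (3 * r + i) ≡ + 3 ℤ.* + r ℤ.+ + i
  +[3r+i] r = trans (pos-+ (3 * r) i) (cong (ℤ._+ + i) (pos-* 3 r))

  -- From i + j ≡ -3m modulo p. This and the next two congruences each extract a 3, together the 27
  -- of the denominator.
  j-factor : ∀ r → + j ℤ.+ argument r ≡[ p ] + 3 ℤ.* (+ r ℤ.- + m)
  j-factor r = mod-trans (mod-+ (+ j) (argument≡ r)) (congruent (ℤ∣.divides 1ℤ (begin
      + j ℤ.+ + (3 * r + i) ℤ.- + 3 ℤ.* (+ r ℤ.- + m)          ≡⟨ cong (λ x → + j ℤ.+ x ℤ.- + 3 ℤ.* (+ r ℤ.- + m)) (+[3r+i] r) ⟩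
      + j ℤ.+ (+ 3 ℤ.* + r ℤ.+ + i) ℤ.- + 3 ℤ.* (+ r ℤ.- + m)  ≡⟨ collect (+ j) (+ r) (+ i) (+ m) ⟩
      1ℤ ℤ.* (+ 3 ℤ.* + m ℤ.+ + i ℤ.+ + j)                    ≡⟨ cong (1ℤ ℤ.*_) +p≡ ⟨
      1ℤ ℤ.* + p                                             ∎)))
    where
    open ≡-Reasoning
    collect : ∀ j r i m → j ℤ.+ (+ 3 ℤ.* r ℤ.+ i) ℤ.- + 3 ℤ.* (r ℤ.- m) ≡ 1ℤ ℤ.* (+ 3 ℤ.* m ℤ.+ i ℤ.+ j)
    collect = ℤ-Ring.solve-∀

  j′-factor : ∀ r → + j′ ℤ.+ argument r ≡[ p ] + 3 ℤ.* + (suc r + c)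
  j′-factor r = mod-trans (mod-+ (+ j′) (argument≡ r)) (subst (+ j′ ℤ.+ + (3 * r + i) ≡[ p ]_) (begin
      + j′ ℤ.+ + (3 * r + i)   ≡⟨ pos-+ j′ (3 * r + i) ⟨
      + (j′ + (3 * r + i))     ≡⟨ cong +_ (regroup j′ r i) ⟩
      + (3 * r + (i + j′))     ≡⟨ cong (λ x → + (3 * r + x)) c≡ ⟩
      + (3 * r + 3 * suc c)    ≡⟨ cong +_ (collect r c) ⟩
      + (3 * (suc r + c))      ≡⟨ pos-* 3 (suc r + c) ⟩
      + 3 ℤ.* + (suc r + c)    ∎) mod-refl)
    where
    open ≡-Reasoning
    regroup : ∀ j r i → j + (3 * r + i) ≡ 3 * r + (i + j)
    regroup = ℕ-Ring.solve-∀
    collect : ∀ r c → 3 * r + 3 * suc c ≡ 3 * (suc r + c)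
    collect = ℕ-Ring.solve-∀

  j″-factor : ∀ r → + j″ ℤ.+ argument r ≡[ p ] + 3 ℤ.* + (suc i + r + L)
  j″-factor r = mod-trans (mod-+ (+ j″) (argument≡ r)) (congruent (ℤ∣.divides -1ℤ (begin
      + j″ ℤ.+ + (3 * r + i) ℤ.- + 3 ℤ.* + (suc i + r + L)
        ≡⟨ cong₂ ℤ._-_ (sym (pos-+ j″ (3 * r + i))) (trans (sym (pos-* 3 (suc i + r + L))) (trans (cong +_ total) (pos-+ (j″ + (3 * r + i)) p))) ⟩
      + (j″ + (3 * r + i)) ℤ.- (+ (j″ + (3 * r + i)) ℤ.+ + p)
        ≡⟨ cancel (+ (j″ + (3 * r + i))) (+ p) ⟩
      -1ℤ ℤ.* + p ∎)))
    where
    open ≡-Reasoning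
    cancel : ∀ x y → x ℤ.- (x ℤ.+ y) ≡ -1ℤ ℤ.* y
    cancel = ℤ-Ring.solve-∀
    regroup : ∀ i r L → 3 * (suc i + r + L) ≡ 3 * r + 3 * (suc i + L)
    regroup = ℕ-Ring.solve-∀
    shuffle : ∀ r i j p → 3 * r + (i + j + p) ≡ j + (3 * r + i) + p
    shuffle = ℕ-Ring.solve-∀
    total : 3 * (suc i + r + L) ≡ j″ + (3 * r + i) + p
    total = trans (regroup i r L) (trans (cong (_+_ (3 * r)) L≡) (shuffle r i j″ p))

  ratio : ℕ → ℤ
  ratio r = (+ r ℤ.- + m) ℤ.* + ((suc r + c) * (suc i + r + L))

  N+1+k≡ : ∀ r → + (n * p + suc (q * p + r)) ≡[ p ] + suc r
  N+1+k≡ r = subst (_≡[ p ] + suc r) (cong +_ (regroup n q p r)) ([q*p+r]≡r p (n + q) (suc r))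
    where
    regroup : ∀ n q p r → (n + q) * p + suc r ≡ n * p + suc (q * p + r)
    regroup = ℕ-Ring.solve-∀

  -- The factor N + k + 1 reduces to r + 1 because p divides N; with 27 it stays apart from `ratio`,
  -- as the denominator contains the same product.
  numerator≡ : ∀ r → numerator i (n * p) (q * p + r) ≡[ p ] + (27 * suc r) ℤ.* ratio r
  numerator≡ r = subst₂ (_≡[ p ]_) (cong (ℤ._* + (n * p + suc (q * p + r))) (sym (factors (argument r)))) rhs
    (mod-* (mod-* (mod-* (j-factor r) (j′-factor r)) (j″-factor r)) (N+1+k≡ r))
    where
    collect : ∀ a b c x → + 3 ℤ.* a ℤ.* (+ 3 ℤ.* b) ℤ.* (+ 3 ℤ.* c) ℤ.* x ≡ + 27 ℤ.* x ℤ.* (a ℤ.* (b ℤ.* c))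
    collect = ℤ-Ring.solve-∀
    rhs : + 3 ℤ.* (+ r ℤ.- + m) ℤ.* (+ 3 ℤ.* + (suc r + c)) ℤ.* (+ 3 ℤ.* + (suc i + r + L)) ℤ.* + suc r ≡ + (27 * suc r) ℤ.* ratio r
    rhs = trans (collect (+ r ℤ.- + m) (+ (suc r + c)) (+ (suc i + r + L)) (+ suc r))
      (cong₂ (λ x y → x ℤ.* ((+ r ℤ.- + m) ℤ.* y)) (sym (pos-* 27 (suc r))) (sym (pos-* (suc r + c) (suc i + r + L))))

  +denominator : ∀ k → + denominator i k ≡ + 27 ℤ.* (+ suc k ℤ.* + suc k ℤ.* + suc k) ℤ.* + (suc k + i)
  +denominator k = begin
    + denominator i k
      ≡⟨ pos-* (27 * (suc k * suc k * suc k)) (suc k + i) ⟩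
    + (27 * (suc k * suc k * suc k)) ℤ.* y
      ≡⟨ cong (ℤ._* y) (pos-* 27 (suc k * suc k * suc k)) ⟩
    + 27 ℤ.* + (suc k * suc k * suc k) ℤ.* y
      ≡⟨ cong (λ w → + 27 ℤ.* w ℤ.* y) (pos-* (suc k * suc k) (suc k)) ⟩
    + 27 ℤ.* (+ (suc k * suc k) ℤ.* + suc k) ℤ.* y
      ≡⟨ cong (λ w → + 27 ℤ.* (w ℤ.* + suc k) ℤ.* y) (pos-* (suc k) (suc k)) ⟩
    + 27 ℤ.* (+ suc k ℤ.* + suc k ℤ.* + suc k) ℤ.* y ∎
    where
    open ≡-Reasoning
    y = + (suc k + i)

  denominator≡ : ∀ r → + denominator i (q * p + r) ≡[ p ] + denominator i r
  denominator≡ r = subst₂ (_≡[ p ]_) (sym (+denominator (q * p + r))) (sym (+denominator r))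
    (mod-* (mod-* {a = + 27} mod-refl (mod-* (mod-* x≡ x≡) x≡)) y≡)
    where
    x≡ : + suc (q * p + r) ≡[ p ] + suc r
    x≡ = subst (λ k → + k ≡[ p ] + suc r) (+-suc (q * p) r) ([q*p+r]≡r p q (suc r))
    regroup : ∀ x r i → x + (suc r + i) ≡ suc (x + r) + i
    regroup = ℕ-Ring.solve-∀
    y≡ : + (suc (q * p + r) + i) ≡[ p ] + (suc r + i)
    y≡ = subst (λ k → + k ≡[ p ] + (suc r + i)) (regroup (q * p) r i) ([q*p+r]≡r p q (suc r + i))

  -- `ratio m` is zero, so the numerator at r = `m` contributes one p and `term m` the other.
  p²∣term[1+m] : + (p ^ 2) ∣ₛ term (suc m)
  p²∣term[1+m] = p^e∣+d*x⇒p^e∣x pr 2 (denominator i (q * p + m)) (p∤denominator-low m m<z)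
    (subst (+ (p ^ 2) ∣ₛ_) (sym (term-step m)) (p∣a∧p∣b⇒p²∣a*b p p∣numerator (p∣term m (<⇒≤ m<z))))
    where
    ratio≡0 : ratio m ≡ 0ℤ
    ratio≡0 = cong (ℤ._* + ((suc m + c) * (suc i + m + L))) (ℤₚ.+-inverseʳ (+ m))
    p∣numerator : + p ∣ₛ numerator i (n * p) (q * p + m)
    p∣numerator = ℤ∣.∣m+n∣n⇒∣m {m = numerator i (n * p) (q * p + m)} (difference (numerator≡ m))
      (subst (λ x → + p ∣ₛ ℤ.- (+ (27 * suc m) ℤ.* x)) (sym ratio≡0)
        (subst (λ x → + p ∣ₛ ℤ.- x) (sym (ℤₚ.*-zeroʳ (+ (27 * suc m)))) (ℤ∣.divides 0ℤ refl)))

  p²∣term-mid : ∀ t → t ≤ 2 * (c + L) + j → + (p ^ 2) ∣ₛ term (suc m + t)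
  p²∣term-mid t t≤ = ∣-run 2 (suc m) t
    (λ u u<t → p∤denominator-low (suc m + u) (+-monoʳ-< (suc m) (<-≤-trans u<t t≤))) p²∣term[1+m]

  U : ℕ → ℤ
  U = saalschützTerm c L i

  U-step : ∀ r → + denominator i r ℤ.* U (suc r) ≡ + (27 * suc r) ℤ.* ratio r ℤ.* U r
  U-step r = begin
    + denominator i r ℤ.* U (suc r)
      ≡⟨ cong (λ x → + x ℤ.* U (suc r)) (split r i) ⟩
    + (27 * suc r * (suc r * suc r * (suc i + r))) ℤ.* U (suc r)
      ≡⟨ cong (ℤ._* U (suc r)) (pos-* (27 * suc r) (suc r * suc r * (suc i + r))) ⟩
    + (27 * suc r) ℤ.* + (suc r * suc r * (suc i + r)) ℤ.* U (suc r)
      ≡⟨ ℤₚ.*-assoc (+ (27 * suc r)) (+ (suc r * suc r * (suc i + r))) (U (suc r)) ⟩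
    + (27 * suc r) ℤ.* (+ (suc r * suc r * (suc i + r)) ℤ.* U (suc r))
      ≡⟨ cong (+ (27 * suc r) ℤ.*_) (saalschützTerm-step c L i r) ⟩
    + (27 * suc r) ℤ.* (ratio r ℤ.* U r)
      ≡⟨ ℤₚ.*-assoc (+ (27 * suc r)) (ratio r) (U r) ⟨
    + (27 * suc r) ℤ.* ratio r ℤ.* U r ∎
    where
    open ≡-Reasoning
    split : ∀ r i → 27 * (suc r * suc r * suc r) * (suc r + i) ≡ 27 * suc r * (suc r * suc r * (suc i + r))
    split = ℕ-Ring.solve-∀

  -- The ratios of `term` and `U` agree only modulo p, but every term in this range already contains
  -- a factor p, which lifts proportionality to p². Cross-multiplied to avoid division.
  proportional : ∀ r → r ≤ m → + (p ^ 2) ∣ₛ U 0 ℤ.* term r ℤ.- U r ℤ.* term 0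
  proportional zero    _   = subst (+ (p ^ 2) ∣ₛ_) (sym (ℤₚ.+-inverseʳ (U 0 ℤ.* term 0))) (ℤ∣.divides 0ℤ refl)
  proportional (suc r) r<m = p^e∣+d*x⇒p^e∣x pr 2 (denominator i r)
    p∤d
    (subst (+ (p ^ 2) ∣ₛ_) (sym combination)
      (ℤ∣.∣m∣n⇒∣m+n
        (ℤ∣.∣m∣n⇒∣m-n
          (ℤ∣.∣n⇒∣m*n (U 0) (p∣a∧p∣b⇒p²∣a*b p (difference (numerator≡ r)) (p∣term r (≤-trans (<⇒≤ r<m) (<⇒≤ m<z)))))
          (ℤ∣.∣n⇒∣m*n (U 0) (p∣a∧p∣b⇒p²∣a*b p (difference (denominator≡ r)) (p∣term (suc r) (≤-trans r<m (<⇒≤ m<z))))))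
        (ℤ∣.∣n⇒∣m*n G (proportional r (<⇒≤ r<m)))))
    where
    open ≡-Reasoning
    D = + denominator i (q * p + r)
    d = + denominator i r
    F = numerator i (n * p) (q * p + r)
    G = + (27 * suc r) ℤ.* ratio r
    p∤d : ¬ (p ∣ₙ denominator i r)
    p∤d p∣d = p∤denominator-low r (<-trans r<m m<z)
      (ℤ∣.∣⇒∣ᵤ (ℤ∣.∣m+n∣n⇒∣m {m = D} (difference (denominator≡ r)) (ℤ∣.∣m⇒∣-m {m = d} (ℤ∣.∣ᵤ⇒∣ p∣d))))
    separate : ∀ d D u x′ u′ x₀ → d ℤ.* (u ℤ.* x′ ℤ.- u′ ℤ.* x₀) ≡
      u ℤ.* (D ℤ.* x′) ℤ.- u ℤ.* ((D ℤ.- d) ℤ.* x′) ℤ.- d ℤ.* u′ ℤ.* x₀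
    separate = ℤ-Ring.solve-∀
    recombine : ∀ F G u x uᵣ x₀ y → u ℤ.* (F ℤ.* x) ℤ.- y ℤ.- G ℤ.* uᵣ ℤ.* x₀ ≡
      u ℤ.* ((F ℤ.- G) ℤ.* x) ℤ.- y ℤ.+ G ℤ.* (u ℤ.* x ℤ.- uᵣ ℤ.* x₀)
    recombine = ℤ-Ring.solve-∀
    -- Trading `D` for `d` and `F` for `G` leaves errors `D ℤ.- d` and `F ℤ.- G`, divisible by p,
    -- each times a term divisible by p.
    combination : d ℤ.* (U 0 ℤ.* term (suc r) ℤ.- U (suc r) ℤ.* term 0) ≡
      U 0 ℤ.* ((F ℤ.- G) ℤ.* term r) ℤ.- U 0 ℤ.* ((D ℤ.- d) ℤ.* term (suc r)) ℤ.+ G ℤ.* (U 0 ℤ.* term r ℤ.- U r ℤ.* term 0)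
    combination = begin
      d ℤ.* (U 0 ℤ.* term (suc r) ℤ.- U (suc r) ℤ.* term 0)
        ≡⟨ separate d D (U 0) (term (suc r)) (U (suc r)) (term 0) ⟩
      U 0 ℤ.* (D ℤ.* term (suc r)) ℤ.- y ℤ.- d ℤ.* U (suc r) ℤ.* term 0
        ≡⟨ cong₂ (λ v w → U 0 ℤ.* v ℤ.- y ℤ.- w ℤ.* term 0) (term-step r) (U-step r) ⟩
      U 0 ℤ.* (F ℤ.* term r) ℤ.- y ℤ.- G ℤ.* U r ℤ.* term 0
        ≡⟨ recombine F G (U 0) (term r) (U r) (term 0) y ⟩
      U 0 ℤ.* ((F ℤ.- G) ℤ.* term r) ℤ.- y ℤ.+ G ℤ.* (U 0 ℤ.* term r ℤ.- U r ℤ.* term 0) ∎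
      where y = U 0 ℤ.* ((D ℤ.- d) ℤ.* term (suc r))

  u₀ : ℕ
  u₀ = rise c 1 * rise L (suc i + 0)

  U0≡+u₀ : U 0 ≡ + u₀
  U0≡+u₀ = trans (ℤₚ.*-identityˡ (+ rise c 1 ℤ.* + rise L (suc i + 0))) (sym (pos-* (rise c 1) (rise L (suc i + 0))))

  -- The factors run over 1, ..., c and i + 1, ..., i + L, all below p by `p≡`.
  p∤u₀ : ¬ (p ∣ₙ u₀)
  p∤u₀ p∣u₀ with euclidsLemma (rise c 1) (rise L (suc i + 0)) pr p∣u₀
  ... | inj₁ p∣ = p∤rise pr c 1 ≤-refl (subst (suc c ≤_) (sym (trans p≡ (regroup c L i j))) (m≤m+n (suc c) _)) p∣
    where
    regroup : ∀ c L i j → 3 * suc (c + L) + i + j ≡ suc c + (2 * suc (c + L) + L + i + j)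
    regroup = ℕ-Ring.solve-∀
  ... | inj₂ p∣ = p∤rise pr L (suc i + 0) (s≤s z≤n) (subst (suc i + 0 + L ≤_) (sym (trans p≡ (regroup c L i j))) (m≤m+n (suc i + 0 + L) _)) p∣
    where
    regroup : ∀ c L i j → 3 * suc (c + L) + i + j ≡ suc i + 0 + L + (2 * suc (c + L) + c + j)
    regroup = ℕ-Ring.solve-∀

  -- Summing `proportional` over r gives `U 0` times this sum congruent to `term 0` times the
  -- Saalschütz sum, which is zero; then `U 0` is cancelled.
  p²∣sum-low : + (p ^ 2) ∣ₛ sumBelow (suc m) term
  p²∣sum-low = p^e∣+d*x⇒p^e∣x pr 2 u₀ p∤u₀ (subst (+ (p ^ 2) ∣ₛ_) eq
    (sumBelow-∣ (suc m) (λ r → U 0 ℤ.* term r ℤ.- U r ℤ.* term 0) (λ { r (s≤s r≤m) → proportional r r≤m })))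
    where
    open ≡-Reasoning
    cancel : ∀ x → x ℤ.- 0ℤ ≡ x
    cancel = ℤ-Ring.solve-∀
    eq : sumBelow (suc m) (λ r → U 0 ℤ.* term r ℤ.- U r ℤ.* term 0) ≡ + u₀ ℤ.* sumBelow (suc m) term
    eq = begin
      sumBelow (suc m) (λ r → U 0 ℤ.* term r ℤ.- U r ℤ.* term 0)
        ≡⟨ sumBelow-∸ (suc m) (λ r → U 0 ℤ.* term r) (λ r → U r ℤ.* term 0) ⟩
      sumBelow (suc m) (λ r → U 0 ℤ.* term r) ℤ.- sumBelow (suc m) (λ r → U r ℤ.* term 0)
        ≡⟨ cong₂ ℤ._-_ (sumBelow-* (suc m) (U 0) term)
             (trans (sumBelow-cong (suc m) (λ r → ℤₚ.*-comm (U r) (term 0))) (sumBelow-* (suc m) (term 0) U)) ⟩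
      U 0 ℤ.* sumBelow (suc m) term ℤ.- term 0 ℤ.* sumBelow (suc m) U
        ≡⟨ cong (λ x → U 0 ℤ.* sumBelow (suc m) term ℤ.- term 0 ℤ.* x) (sum-saalschützTerm≡0 c L i) ⟩
      U 0 ℤ.* sumBelow (suc m) term ℤ.- term 0 ℤ.* 0ℤ
        ≡⟨ cong (λ x → U 0 ℤ.* sumBelow (suc m) term ℤ.- x) (ℤₚ.*-zeroʳ (term 0)) ⟩
      U 0 ℤ.* sumBelow (suc m) term ℤ.- 0ℤ
        ≡⟨ cancel (U 0 ℤ.* sumBelow (suc m) term) ⟩
      U 0 ℤ.* sumBelow (suc m) term
        ≡⟨ cong (ℤ._* sumBelow (suc m) term) U0≡+u₀ ⟩
      + u₀ ℤ.* sumBelow (suc m) term ∎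

  -- For r from 0 to m only the sum of the terms is controlled; from m + 1 to `z`, and from p - i to
  -- p - 1, each term is divisible on its own.
  p²∣sum-block : + (p ^ 2) ∣ₛ sumBelow p term
  p²∣sum-block = subst (λ l → + (p ^ 2) ∣ₛ sumBelow l term) z+i≡
    (subst (+ (p ^ 2) ∣ₛ_) (sym (sumBelow-+ (suc z) i term))
      (ℤ∣.∣m∣n⇒∣m+n p²∣sum-mid (sumBelow-∣ i (λ t → term (suc z + t)) p²∣term-high)))
    where
    p²∣sum-mid : + (p ^ 2) ∣ₛ sumBelow (suc z) term
    p²∣sum-mid = subst (λ l → + (p ^ 2) ∣ₛ sumBelow l term) (+-suc (suc m) (2 * (c + L) + j))
      (subst (+ (p ^ 2) ∣ₛ_) (sym (sumBelow-+ (suc m) (suc (2 * (c + L) + j)) term))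
        (ℤ∣.∣m∣n⇒∣m+n p²∣sum-low
          (sumBelow-∣ (suc (2 * (c + L) + j)) (λ t → term (suc m + t)) (λ { t (s≤s t≤) → p²∣term-mid t t≤ }))))

-- From blocks to the whole sum

-- The added terms have 3k + i > N and vanish; for N = np the longer range consists of whole blocks.
a≡sumBelow : ∀ i N → 1 ≤ i → 1 ≤ N → a i N ≡ sumBelow N (aTerm i N)
-- The sum up to `M` inclusive has `suc M` terms; they fit below `N` because `M` is at most `N′`.
a≡sumBelow i@(suc i′) N@(suc N′) _ _ with m≤n⇒∃[o]m+o≡n (s≤s (≤-trans (m/n≤m (N′ ∸ i′) 3) (m∸n≤m N′ i′)))
... | o , 1+M+o≡N = begin
  sumBelow (suc M) (aTerm i N)
    ≡⟨ ℤₚ.+-identityʳ (sumBelow (suc M) (aTerm i N)) ⟨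
  sumBelow (suc M) (aTerm i N) ℤ.+ 0ℤ
    ≡⟨ cong (ℤ._+_ (sumBelow (suc M) (aTerm i N))) tail≡0 ⟨
  sumBelow (suc M) (aTerm i N) ℤ.+ sumBelow o (λ t → aTerm i N (suc M + t))
    ≡⟨ sumBelow-+ (suc M) o (aTerm i N) ⟨
  sumBelow (suc M + o) (aTerm i N)
    ≡⟨ cong (λ l → sumBelow l (aTerm i N)) 1+M+o≡N ⟩
  sumBelow N (aTerm i N) ∎
  where
  open ≡-Reasoning
  M = (N ∸ i) / 3
  N<3k+i : ∀ t → N < 3 * (suc M + t) + i
  N<3k+i t = ≤-Reasoning.begin-strict
    N                                ≤-Reasoning.≤⟨ m≤n+m∸n N i ⟩
    i + (N ∸ i)                      ≤-Reasoning.≡⟨ cong (_+_ i) (m≡m%n+[m/n]*n (N ∸ i) 3) ⟩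
    i + ((N ∸ i) % 3 + M * 3)        ≤-Reasoning.<⟨ +-monoʳ-< i (+-monoˡ-< (M * 3) (m%n<n (N ∸ i) 3)) ⟩
    i + suc M * 3                    ≤-Reasoning.≡⟨ swap i (suc M) ⟩
    3 * suc M + i                    ≤-Reasoning.≤⟨ +-monoˡ-≤ i (*-monoʳ-≤ 3 (m≤m+n (suc M) t)) ⟩
    3 * (suc M + t) + i              ≤-Reasoning.∎
    where
    swap : ∀ i x → i + x * 3 ≡ 3 * x + i
    swap = ℕ-Ring.solve-∀
  tail≡0 : sumBelow o (λ t → aTerm i N (suc M + t)) ≡ 0ℤ
  tail≡0 = trans (sumBelow-cong o (λ t → aTerm≡0 i N (suc M + t) (N<3k+i t))) (sum-replicate-zero o)

theorem3p1 : ∀ (p n i : ℕ) → Prime p → 5 ≤ p → 1 ≤ n → 1 ≤ i → 3 * i < p → + (p ^ 2) ∣ a i (p * n)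
theorem3p1 p n i pr 5≤p 1≤n 1≤i 3i<p = ℤ∣.∣⇒∣ᵤ (subst (+ (p ^ 2) ∣ₛ_)
  (sym (trans (cong (a i) (*-comm p n)) (a≡sumBelow i (n * p) 1≤i (*-mono-≤ 1≤n (≤-trans (s≤s z≤n) 5≤p)))))
  (sumBelow-blocks-∣ p n (aTerm i (n * p)) (Block.p²∣sum-block pr 5≤p 1≤i 3i<p R n)))
  where
  3∤p : ¬ (3 ∣ₙ p)
  3∤p 3∣p with prime⇒irreducible pr 3∣p
  ... | inj₂ refl = <⇒≱ 5≤p (s≤s (s≤s (s≤s z≤n)))
  R = residues p i 3i<p 1≤i 3∤p
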